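{- Let $D=(V,A)$ be a digraph. (a) With $\varphi(\sigma):=\sum_{\gamma}(\ell(\gamma)-1)$ for $\sigma\in\mathfrak{S}_V$ (sum over the cycles $\gamma$ of $\sigma$ that are $D$-cycles), we have \[\#\{\text{hamps of }\overline{D}\}=\sum_{\sigma\in\mathfrak{S}_V(D,\overline{D})}(-1)^{\varphi(\sigma)}.\] (b) $\#\{\text{hamps of }\overline{D}\}\equiv|\mathfrak{S}_V(D,\overline{D})|\pmod 2$.
   Context: A digraph is $D=(V,A)$ with $V$ finite and $A\subseteq V\times V$; $\overline{D}=(V,(V\times V)\setminus A)$. For a digraph $E=(V,B)$ an $E$-path is a nonempty tuple $v=(v_1,\dots,v_k)$ of distinct elements of $V$ with $(v_i,v_{i+1})\in B$ for all $i\in[k-1]$; a hamp of $E$ is an $E$-path containing every vertex; by convention, when $V=\varnothing$ the empty list counts as a hamp. The cycles of $\sigma\in\mathfrak{S}_V$ are the rotation-equivalence classes (under cyclic rotation) of tuples $(i,\sigma(i),\dots,\sigma^{k-1}(i))$ with $k$ minimal such that $\sigma^k(i)=i$; $\ell(\gamma)$ is the length of its tuples; for the class $\gamma$ of $(v_1,\dots,v_k)$, $\operatorname{CArcs}\gamma=\{(v_1,v_2),\dots,(v_{k-1},v_k),(v_k,v_1)\}$. A $D$-cycle is a rotation-equivalence class $\gamma$ of nonempty tuples of distinct elements of $V$ with $\operatorname{CArcs}\gamma\subseteq A$ (analogously $\overline{D}$-cycle). $\mathfrak{S}_V(D,\overline{D})$ is the set of $\sigma\in\mathfrak{S}_V$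 all of whose cycles are $D$-cycles or $\overline{D}$-cycles. -}

module Defs where

open import Data.Bool using (Bool; true; false; not; _∧_; _∨_; if_then_else_)
open import Data.Nat using (ℕ; zero; suc; _∸_; _≡ᵇ_; _≤ᵇ_)
open import Data.Fin using (Fin; toℕ)
open import Data.List using (List; []; _∷_; map; concatMap; filterᵇ; length; upTo; allFin; foldr)
open import Data.Vec.Functional using () renaming (_∷_ to _◂_)
open import Data.Integer as ℤ using (ℤ)
open import Data.Nat.ListAction using (sum)
open import Data.Bool.ListAction using (and)

Digraph : ℕ → Set
Digraph n = Fin n → Fin n → Bool

complement : ∀ {n} → Digraph n → Digraph n
complement D u v = not (D u v)

∀Fin : ∀ n → (Fin n → Bool) → Bool
∀Fin n p = and (map p (allFin n))

∀Below : ℕ → (ℕ → Bool) → Bool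
∀Below k p = and (map p (upTo k))

_≡ᶠ_ : ∀ {n} → Fin n → Fin n → Bool
i ≡ᶠ j = toℕ i ≡ᵇ toℕ j

-- The list of all functions Fin n → Fin m (each exactly once, up to extensionality).
allFuns : ∀ n m → List (Fin n → Fin m)
allFuns zero    m = (λ ()) ∷ []
allFuns (suc n) m = concatMap (λ f → map (λ x → x ◂ f) (allFin m)) (allFuns n m)

-- injectivity (for endofunctions of Fin n this is bijectivity)
isInjective : ∀ {n} → (Fin n → Fin n) → Bool
isInjective {n} σ = ∀Fin n λ i → ∀Fin n λ j → not (σ i ≡ᶠ σ j) ∨ (i ≡ᶠ j)

Perms : ∀ n → List (Fin n → Fin n)
Perms n = filterᵇ isInjective (allFuns n n)

-- Hamiltonian paths of a digraph E on Fin n: a tuple (v_0,…,v_{n-1})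
-- (= a function Fin n → Fin n) of distinct vertices (so containing every vertex)
-- with (v_k, v_{k+1}) an arc of E for every consecutive pair.
-- For n = 0 the single empty tuple is a hamp, as by the paper's convention.
isHamp : ∀ {n} → Digraph n → (Fin n → Fin n) → Bool
isHamp {n} E v = isInjective v ∧
  (∀Fin n λ k → ∀Fin n λ l → not (toℕ l ≡ᵇ suc (toℕ k)) ∨ E (v k) (v l))

hamps : ∀ {n} → Digraph n → List (Fin n → Fin n)
hamps {n} E = filterᵇ (isHamp E) (allFuns n n)

iter : ∀ {n} → (Fin n → Fin n) → ℕ → Fin n → Fin n
iter σ zero    i = i
iter σ (suc k) i = σ (iter σ k i)

-- ℓ: length of the cycle of σ through i = least k ≥ 1 with σ^k(i) = i
-- (searched among 1..n; for a permutation it always exists there).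
cycLen : ∀ {n} → (Fin n → Fin n) → Fin n → ℕ
cycLen {n} σ i = go 1 n
  where
  go : ℕ → ℕ → ℕ
  go k zero    = k
  go k (suc f) = if iter σ k i ≡ᶠ i then k else go (suc k) f

-- The cycle γ of σ through i is the class of (i, σ i, …, σ^{ℓ-1} i), whose
-- CArcs are (σ^j i, σ^{j+1} i) for j < ℓ.
-- γ is an E-cycle iff all its CArcs are arcs of E.
isCycleOf : ∀ {n} → Digraph n → (Fin n → Fin n) → Fin n → Bool
isCycleOf E σ i = ∀Below (cycLen σ i) λ j → E (iter σ j i) (iter σ (suc j) i)

-- Each cycle of σ is represented exactly once, by its least element.
isCycleRep : ∀ {n} → (Fin n → Fin n) → Fin n → Bool
isCycleRep σ i = ∀Below (cycLen σ i) λ j → toℕ i ≤ᵇ toℕ (iter σ j i)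

isDD̄ : ∀ {n} → Digraph n → (Fin n → Fin n) → Bool
isDD̄ {n} D σ = ∀Fin n λ i → isCycleOf D σ i ∨ isCycleOf (complement D) σ i

SDD̄ : ∀ {n} → Digraph n → List (Fin n → Fin n)
SDD̄ {n} D = filterᵇ (isDD̄ D) (Perms n)

φ : ∀ {n} → Digraph n → (Fin n → Fin n) → ℕ
φ {n} D σ = sum (map (λ i → if isCycleRep σ i ∧ isCycleOf D σ i then cycLen σ i ∸ 1 else 0)
                     (allFin n))

signedSum : ∀ {n} → Digraph n → ℤ
signedSum D = foldr ℤ._+_ ℤ.0ℤ (map (λ σ → ℤ.-1ℤ ℤ.^ φ D σ) (SDD̄ D))

{-# OPTIONS --safe #-}

-- Put b(u,v) = -1 for an arc of D and 0 otherwise. The hamps of the complement are counted by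
-- the sum, over all arrangements w of V, of the product of 1 + b over consecutive pairs of w,
-- while the signed sum is the sum, over all permutations, of the product over the cycles γ of
-- ∏(1+b) - ∏b, both products running over CArcs γ. These two sums agree for arbitrary b, by
-- induction on the number of vertices. Take the cycle through a fixed vertex x, and use the
-- induction hypothesis to replace the other cycles by an arrangement of their vertices; the
-- claim becomes that inserting x at a cut of an arrangement of V \ {x} has the same total weight
-- as closing the part before the cut into a cycle through x. Both totals are affine in the row
-- b(x,·); their constant terms agree cut by cut, and the coefficient of b(x,t) is the same pair of
-- totals for the digraph in which x → t is contracted to one vertex with the in-weights of x and
-- the out-weights of t.

module Submission where

open import Defs
open import Data.Bool using (Bool; true; false; T; not; _∧_; _∨_; if_then_else_)
open import Data.Bool.ListAction using (and)
open import Data.Empty using (⊥-elim)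
open import Data.Fin using (Fin; zero; suc; toℕ)
import Data.Fin as Fin
import Data.Fin.Properties as Fin
open import Data.Integer using (ℤ; 0ℤ; 1ℤ; -1ℤ; _+_; _*_; _-_; -_; _^_)
import Data.Integer as ℤ
open import Data.Integer.Properties
open import Data.Integer.Tactic.RingSolver using (solve-∀)
open import Data.List using (List; []; _∷_; _++_; _∷ʳ_; map; foldr; filterᵇ; concatMap; length; allFin; applyUpTo; tabulate)
open import Data.List.Membership.Propositional using (_∈_; _∉_)
open import Data.List.Membership.Propositional.Properties using (∈-map⁻; ∈-map⁺; ∈-allFin; ∈-∃++; ∈-++⁺ˡ; ∈-++⁺ʳ)
open import Data.List.Properties using (map-tabulate; map-∘; map-++; map-upTo; map-applyUpTo; ++-assoc; length-tabulate; length-map; length-++)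
open import Data.List.Relation.Binary.Permutation.Propositional using (_↭_; ↭-refl; ↭-sym; ↭-trans; ↭-reflexive; ↭⇒↭ₛ; prep; swap; module PermutationReasoning)
import Data.List.Relation.Binary.Permutation.Propositional.Properties as Perm
import Data.List.Relation.Binary.Permutation.Setoid.Properties as PermSetoid
open import Data.List.Relation.Unary.All as All using (All; []; _∷_)
import Data.List.Relation.Unary.All.Properties as All
open import Data.List.Relation.Unary.AllPairs as AllPairs using (AllPairs; []; _∷_)
import Data.List.Relation.Unary.AllPairs.Properties as AllPairs
open import Data.List.Relation.Unary.Any using (here; there)
open import Data.List.Relation.Unary.Unique.Propositional using (Unique)
open import Data.List.Relation.Unary.Unique.Propositional.Properties using (Unique[x∷xs]⇒x∉xs; allFin⁺)
open import Data.Nat using (ℕ; zero; suc; _%_)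
import Data.Nat as ℕ
open import Data.Nat.DivMod using ([m+kn]%n≡m%n)
open import Data.Nat.ListAction using (sum)
import Data.Nat.Properties as ℕ
open import Data.Product using (∃; _×_; _,_; proj₁; proj₂; uncurry)
open import Data.Sum using (_⊎_; inj₁; inj₂)
open import Data.Vec as Vec using (Vec; []; _∷_; toList)
open import Data.Vec.Functional using () renaming (_∷_ to _◂_)
open import Function using (_∘_; const)
open import Relation.Binary.PropositionalEquality
open import Relation.Nullary using (does; yes; no)

private variable
  A B V : Set
  k : ℕ

-- The weighted identity between arrangements and permutations

-- The second argument of `F` is what remains after the pick, in order, with its length in the type,
-- so that nested sums recurse on `k`.
Σpick : Vec V (suc k) → (V → Vec V k → ℤ) → ℤ
Σpick (x ∷ [])         F = F x []
Σpick (x ∷ S@(_ ∷ _)) F = F x S + Σpick S (λ t S′ → F t (x ∷ S′))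

-- The index set of `Σpick`, for summands that can be rewritten only with what is known about the
-- picked entry and the remainder.
data Pick {V : Set} : Vec V (suc k) → V → Vec V k → Set where
  here  : ∀ {x} {S : Vec V k} → Pick (x ∷ S) x S
  there : ∀ {x t} {S : Vec V (suc k)} {S′} → Pick S t S′ → Pick (x ∷ S) t (x ∷ S′)

Σpick-∷ : ∀ x (S : Vec V (suc k)) (F : V → Vec V (suc k) → ℤ) →
  Σpick (x ∷ S) F ≡ F x S + Σpick S (λ t S′ → F t (x ∷ S′))
Σpick-∷ x (_ ∷ _) F = refl

Σpick-congᴾ : (S : Vec V (suc k)) {F G : V → Vec V k → ℤ} →
  (∀ {t S′} → Pick S t S′ → F t S′ ≡ G t S′) → Σpick S F ≡ Σpick S G
Σpick-congᴾ (x ∷ [])         e = e here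
Σpick-congᴾ (x ∷ S@(_ ∷ _)) e = cong₂ _+_ (e here) (Σpick-congᴾ S (λ p → e (there p)))

Σpick-cong : (S : Vec V (suc k)) {F G : V → Vec V k → ℤ} →
  (∀ t S′ → F t S′ ≡ G t S′) → Σpick S F ≡ Σpick S G
Σpick-cong S e = Σpick-congᴾ S (λ _ → e _ _)

+-interchange : ∀ a b c d → (a + b) + (c + d) ≡ (a + c) + (b + d)
+-interchange = solve-∀

*-leftComm : ∀ a b c → a * (b * c) ≡ b * (a * c)
*-leftComm = solve-∀

Σpick-+ : (S : Vec V (suc k)) (F G : V → Vec V k → ℤ) →
  Σpick S (λ t S′ → F t S′ + G t S′) ≡ Σpick S F + Σpick S G
Σpick-+ (x ∷ [])         F G = refl
Σpick-+ (x ∷ S@(_ ∷ _)) F G = trans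
  (cong (F x S + G x S +_) (Σpick-+ S _ _)) (+-interchange (F x S) (G x S) _ _)

Σpick-* : (S : Vec V (suc k)) (c : ℤ) (F : V → Vec V k → ℤ) →
  Σpick S (λ t S′ → c * F t S′) ≡ c * Σpick S F
Σpick-* (x ∷ [])         c F = refl
Σpick-* (x ∷ S@(_ ∷ _)) c F = trans
  (cong (c * F x S +_) (Σpick-* S c _)) (sym (*-distribˡ-+ c (F x S) _))

-- Both sides run over ordered pairs of distinct positions. The pairs in which `x` is chosen first,
-- second or not at all match up, the last kind by induction.
Σpick-swap : (S : Vec V (suc (suc k))) (F : V → V → Vec V k → ℤ) →
  Σpick S (λ s S′ → Σpick S′ (λ t → F s t)) ≡ Σpick S (λ t S′ → Σpick S′ (λ s → F s t))
Σpick-swap (x ∷ y ∷ [])        F = +-comm (F x y []) (F y x [])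
Σpick-swap (x ∷ S@(_ ∷ _ ∷ _)) F = begin
  X + Σpick S (λ s S′ → Σpick (x ∷ S′) (λ t → F s t))
    ≡⟨ cong (X +_) (trans (Σpick-cong S (λ s S′ → Σpick-∷ x S′ (F s)))
        (Σpick-+ S (λ s → F s x) (λ s S′ → Σpick S′ (λ t S″ → F s t (x ∷ S″))))) ⟩
  X + (Y + Σpick S (λ s S′ → Σpick S′ (λ t S″ → F s t (x ∷ S″))))
    ≡⟨ cong (λ z → X + (Y + z)) (Σpick-swap S (λ s t S″ → F s t (x ∷ S″))) ⟩
  X + (Y + Z)
    ≡⟨ rot X Y Z ⟩
  Y + (X + Z)
    ≡⟨ cong (Y +_) (trans (Σpick-cong S (λ t S′ → Σpick-∷ x S′ (λ s → F s t)))
        (Σpick-+ S (λ t → F x t) (λ t S′ → Σpick S′ (λ s S″ → F s t (x ∷ S″))))) ⟨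
  Y + Σpick S (λ t S′ → Σpick (x ∷ S′) (λ s → F s t)) ∎
  where
  open ≡-Reasoning
  X = Σpick S (λ t → F x t)
  Y = Σpick S (λ s → F s x)
  Z = Σpick S (λ t S′ → Σpick S′ (λ s S″ → F s t (x ∷ S″)))
  rot : ∀ a b c → a + (b + c) ≡ b + (a + c)
  rot = solve-∀

module WeightedSums {V : Set} (b : V → V → ℤ) where

  -- The sum over the arrangements of `S` of the product of 1 + weight along consecutive pairs; `g`
  -- weights the arc entering the first vertex, and `g = 𝟎` means that nothing precedes it.
  pathSum : (V → ℤ) → Vec V k → ℤ
  pathSum {zero}  g S = 1ℤ
  pathSum {suc k} g S = Σpick S λ t S′ → (1ℤ + g t) * pathSum (b t) S′

  -- The sum over all permutations of S of ∏ over cycles of (∏(1+b) - ∏b), the cycle through the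
  -- first vertex being chosen first. In openCycleSum this cycle is under construction: α and β
  -- are the products of 1+b and of b along it so far, f gives the weights of the arcs closing it,
  -- and c and g are the weights of the arcs leaving its current end.
  cycleSum : Vec V k → ℤ
  openCycleSum : (f : V → ℤ) (c : ℤ) (g : V → ℤ) (α β : ℤ) → Vec V k → ℤ

  cycleSum {zero}  []      = 1ℤ
  cycleSum {suc k} (x ∷ S) = openCycleSum (λ t → b t x) (b x x) (b x) 1ℤ 1ℤ S

  openCycleSum {zero}  f c g α β S = (α * (1ℤ + c) - β * c) * cycleSum S
  openCycleSum {suc k} f c g α β S = (α * (1ℤ + c) - β * c) * cycleSum S +
    Σpick S λ t S′ → openCycleSum f (f t) (b t) (α * (1ℤ + g t)) (β * g t) S′

  -- The analogue of pathSum h for S plus one extra vertex with in-weights f and out-weights g,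
  -- where e is the weight of the arc entering the extra vertex if it comes first.
  insertSum : (f g h : V → ℤ) (e : ℤ) → Vec V k → ℤ
  insertSum {zero}  f g h e S = (1ℤ + e) * pathSum g S
  insertSum {suc k} f g h e S = (1ℤ + e) * pathSum g S +
    Σpick S λ t S′ → (1ℤ + h t) * insertSum f g (b t) (f t) S′

  𝟎 : V → ℤ
  𝟎 = const 0ℤ

  -- In an arrangement of `x ∷ S`, either `x` is first, or some `t` of `S` is and `x` is inserted
  -- after it.
  pathSum-∷ : ∀ h x (S : Vec V k) →
    pathSum h (x ∷ S) ≡ insertSum (λ t → b t x) (b x) h (h x) S
  pathSum-∷ {zero}  h x [] = refl
  pathSum-∷ {suc k} h x S  = trans (Σpick-∷ x S _)
    (cong ((1ℤ + h x) * pathSum (b x) S +_)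
      (Σpick-cong S (λ t S′ → cong ((1ℤ + h t) *_) (pathSum-∷ (b t) x S′))))

  -- The factor `1ℤ + 0ℤ` is kept because it is what `pathSum 𝟎` unfolds to.
  1+-split : ∀ a x → (1ℤ + a) * x ≡ (1ℤ + 0ℤ) * x + a * x
  1+-split = solve-∀

  -- `g` enters only through the arc into the first vertex, so the sum is affine in `g`.
  pathSum-expand : ∀ g (S : Vec V (suc k)) →
    pathSum g S ≡ pathSum 𝟎 S + Σpick S (λ t S′ → g t * pathSum (b t) S′)
  pathSum-expand g S = trans (Σpick-cong S (λ t S′ → 1+-split (g t) _)) (Σpick-+ S _ _)

  -- The coefficient of g t has the extra vertex contracted with its successor t.
  insertSum-expand : ∀ f g h e (S : Vec V (suc k)) →
    insertSum f g h e S ≡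
    insertSum f 𝟎 h e S + Σpick S (λ t S′ → g t * insertSum f (b t) h e S′)
  insertSum-expand {zero} f g h e (x ∷ []) = ring e (g x) (h x) (f x)
    where
    ring : ∀ e g h f → (1ℤ + e) * ((1ℤ + g) * 1ℤ) + (1ℤ + h) * ((1ℤ + f) * 1ℤ) ≡
      (1ℤ + e) * ((1ℤ + 0ℤ) * 1ℤ) + (1ℤ + h) * ((1ℤ + f) * 1ℤ) + g * ((1ℤ + e) * 1ℤ)
    ring = solve-∀
  insertSum-expand {suc k} f g h e S = begin
    (1ℤ + e) * pathSum g S + Σpick S (λ s S′ → (1ℤ + h s) * insertSum f g (b s) (f s) S′)
      ≡⟨ cong₂ _+_ (cong ((1ℤ + e) *_) (pathSum-expand g S)) (Σpick-cong S λ s S′ →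
           trans (cong ((1ℤ + h s) *_) (insertSum-expand f g (b s) (f s) S′))
             (trans (*-distribˡ-+ (1ℤ + h s) (insertSum f 𝟎 (b s) (f s) S′) _)
               (cong ((1ℤ + h s) * insertSum f 𝟎 (b s) (f s) S′ +_)
                 (sym (Σpick-* S′ (1ℤ + h s) _))))) ⟩
    (1ℤ + e) * (pathSum 𝟎 S + P) + Σpick S (λ s S′ → (1ℤ + h s) * insertSum f 𝟎 (b s) (f s) S′
      + Σpick S′ (λ t S″ → (1ℤ + h s) * (g t * insertSum f (b t) (b s) (f s) S″)))
      ≡⟨ cong ((1ℤ + e) * (pathSum 𝟎 S + P) +_) (Σpick-+ S _ _) ⟩
    (1ℤ + e) * (pathSum 𝟎 S + P) + (I + Q)
      ≡⟨ ring e (pathSum 𝟎 S) P I Q ⟩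
    (1ℤ + e) * pathSum 𝟎 S + I + ((1ℤ + e) * P + Q)
      ≡⟨ cong ((1ℤ + e) * pathSum 𝟎 S + I +_) (begin
           (1ℤ + e) * P + Q
             -- Picking the successor `t` of the extra vertex before the first vertex `s` lets `g t`
             -- factor out and leaves the recursion of `insertSum f (b t) h e`.
             ≡⟨ cong₂ _+_ (sym (Σpick-* S (1ℤ + e) _)) (Σpick-swap S _) ⟩
           Σpick S (λ t S′ → (1ℤ + e) * (g t * pathSum (b t) S′)) +
           Σpick S (λ t S′ → Σpick S′ (λ s S″ →
             (1ℤ + h s) * (g t * insertSum f (b t) (b s) (f s) S″)))
             ≡⟨ Σpick-+ S _ _ ⟨
           Σpick S (λ t S′ → (1ℤ + e) * (g t * pathSum (b t) S′) +
             Σpick S′ (λ s S″ → (1ℤ + h s) * (g t * insertSum f (b t) (b s) (f s) S″)))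
             ≡⟨ Σpick-cong S (λ t S′ → trans
                  (cong₂ _+_ (*-leftComm (1ℤ + e) (g t) _)
                    (trans (Σpick-cong S′ (λ s S″ → *-leftComm (1ℤ + h s) (g t) _))
                      (Σpick-* S′ (g t) _)))
                  (sym (*-distribˡ-+ (g t) _ _))) ⟩
           Σpick S (λ t S′ → g t * insertSum f (b t) h e S′) ∎) ⟩
    insertSum f 𝟎 h e S + Σpick S (λ t S′ → g t * insertSum f (b t) h e S′) ∎
    where
    open ≡-Reasoning
    P = Σpick S (λ t S′ → g t * pathSum (b t) S′)
    I = Σpick S (λ s S′ → (1ℤ + h s) * insertSum f 𝟎 (b s) (f s) S′)
    Q = Σpick S (λ s S′ → Σpick S′ (λ t S″ →
          (1ℤ + h s) * (g t * insertSum f (b t) (b s) (f s) S″)))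
    ring : ∀ e p P I Q →
      (1ℤ + e) * (p + P) + (I + Q) ≡ (1ℤ + e) * p + I + ((1ℤ + e) * P + Q)
    ring = solve-∀

  -- `α` and `β` are only multiplied by later factors, and they enter linearly when the cycle
  -- closes.
  openCycleSum-linear : ∀ f c g α β z α′ β′ (S : Vec V k) →
    openCycleSum f c g (α + z * α′) (β + z * β′) S ≡
    openCycleSum f c g α β S + z * openCycleSum f c g α′ β′ S
  openCycleSum-linear {zero} f c g α β z α′ β′ S = ring α β z α′ β′ c (cycleSum S)
    where
    ring : ∀ α β z α′ β′ c r → ((α + z * α′) * (1ℤ + c) - (β + z * β′) * c) * r ≡
      (α * (1ℤ + c) - β * c) * r + z * ((α′ * (1ℤ + c) - β′ * c) * r)
    ring = solve-∀
  openCycleSum-linear {suc k} f c g α β z α′ β′ S = trans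
    (cong ((((α + z * α′) * (1ℤ + c) - (β + z * β′) * c) * cycleSum S) +_)
      (trans
        (Σpick-cong S (λ t S′ → trans
          (cong₂ (λ p q → openCycleSum f (f t) (b t) p q S′)
            (distr α z α′ (1ℤ + g t)) (distr β z β′ (g t)))
          (openCycleSum-linear f (f t) (b t) _ _ z _ _ S′)))
        (trans (Σpick-+ S _ _) (cong (X +_) (Σpick-* S z _)))))
    (ring α β z α′ β′ c (cycleSum S) X _)
    where
    X = Σpick S λ t S′ → openCycleSum f (f t) (b t) (α * (1ℤ + g t)) (β * g t) S′
    distr : ∀ a z a′ g → (a + z * a′) * g ≡ a * g + z * (a′ * g)
    distr = solve-∀
    ring : ∀ α β z α′ β′ c r X Y →
      ((α + z * α′) * (1ℤ + c) - (β + z * β′) * c) * r + (X + z * Y) ≡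
      (α * (1ℤ + c) - β * c) * r + X + z * ((α′ * (1ℤ + c) - β′ * c) * r + Y)
    ring = solve-∀

  -- One induction on the number of vertices, together with the two statements below:
  -- `cycleSum (x ∷ S)` opens a cycle at `x`, and sums over open cycles refer back only to
  -- `cycleSum` of `S` or of fewer vertices.
  cycleSum≡pathSum : (S : Vec V k) → cycleSum S ≡ pathSum 𝟎 S

  -- With `β` zero the open cycle contributes only its product of 1 + b, so its closing arc reads as
  -- an arc into an extra vertex with in-weights `f`. The out-weights are 0 since the arrangement of
  -- the other vertices starts afresh.
  openCycleSum-β0 : ∀ f c g α (S : Vec V k) →
    openCycleSum f c g α 0ℤ S ≡ α * insertSum f 𝟎 g c S

  -- The open cycle counts as a single vertex with in-weights `f` and out-weights `g`. Its loop
  -- weight `c` cancels, as (1 + c) - c = 1, and both sides are compared as affine functions of `g`.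
  openCycleSum-11 : ∀ f c g (S : Vec V k) →
    openCycleSum f c g 1ℤ 1ℤ S ≡ insertSum f g 𝟎 0ℤ S

  cycleSum≡pathSum []      = refl
  cycleSum≡pathSum (x ∷ S) =
    trans (openCycleSum-11 (λ t → b t x) (b x x) (b x) S) (sym (pathSum-∷ 𝟎 x S))

  openCycleSum-β0 {zero} f c g α [] = ring α c
    where
    ring : ∀ α c → (α * (1ℤ + c) - 0ℤ * c) * 1ℤ ≡ α * ((1ℤ + c) * 1ℤ)
    ring = solve-∀
  openCycleSum-β0 {suc k} f c g α S = trans
    (cong₂ (λ p q → (α * (1ℤ + c) - 0ℤ * c) * p + q) (cycleSum≡pathSum S)
      (trans
        (Σpick-cong S (λ t S′ → trans
          (openCycleSum-β0 f (f t) (b t) (α * (1ℤ + g t)) S′)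
          (*-assoc α (1ℤ + g t) _)))
        (Σpick-* S α _)))
    (ring α c (pathSum 𝟎 S) _)
    where
    ring : ∀ α c p X →
      (α * (1ℤ + c) - 0ℤ * c) * p + α * X ≡ α * ((1ℤ + c) * p + X)
    ring = solve-∀

  openCycleSum-11 {zero} f c g [] = ring c
    where
    ring : ∀ c → (1ℤ * (1ℤ + c) - 1ℤ * c) * 1ℤ ≡ (1ℤ + 0ℤ) * 1ℤ
    ring = solve-∀
  openCycleSum-11 {suc k} f c g S = begin
    (1ℤ * (1ℤ + c) - 1ℤ * c) * cycleSum S +
      Σpick S (λ t S′ → openCycleSum f (f t) (b t) (1ℤ * (1ℤ + g t)) (1ℤ * g t) S′)
      ≡⟨ cong₂ _+_ (trans (ring c (cycleSum S)) (cong ((1ℤ + 0ℤ) *_) (cycleSum≡pathSum S)))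
           (Σpick-cong S (λ t S′ → begin
              openCycleSum f (f t) (b t) (1ℤ * (1ℤ + g t)) (1ℤ * g t) S′
                -- (1 + g t, g t) = (1, 0) + g t (1, 1): linearity separates the constant term,
                -- where `β` is 0, from the coefficient of `g t`, an instance of the statement
                -- itself with `t` contracted into the start of the cycle.
                ≡⟨ cong₂ (λ p q → openCycleSum f (f t) (b t) p q S′) (ring₁ (g t)) (ring₂ (g t)) ⟩
              openCycleSum f (f t) (b t) (1ℤ + g t * 1ℤ) (0ℤ + g t * 1ℤ) S′
                ≡⟨ openCycleSum-linear f (f t) (b t) 1ℤ 0ℤ (g t) 1ℤ 1ℤ S′ ⟩
              openCycleSum f (f t) (b t) 1ℤ 0ℤ S′ + g t * openCycleSum f (f t) (b t) 1ℤ 1ℤ S′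
                ≡⟨ cong₂ _+_ (openCycleSum-β0 f (f t) (b t) 1ℤ S′)
                     (cong (g t *_) (openCycleSum-11 f (f t) (b t) S′)) ⟩
              (1ℤ + 0ℤ) * insertSum f 𝟎 (b t) (f t) S′ + g t * insertSum f (b t) 𝟎 0ℤ S′ ∎)) ⟩
    (1ℤ + 0ℤ) * pathSum 𝟎 S + Σpick S (λ t S′ →
      (1ℤ + 0ℤ) * insertSum f 𝟎 (b t) (f t) S′ + g t * insertSum f (b t) 𝟎 0ℤ S′)
      ≡⟨ cong ((1ℤ + 0ℤ) * pathSum 𝟎 S +_) (Σpick-+ S I G) ⟩
    (1ℤ + 0ℤ) * pathSum 𝟎 S + (Σpick S I + Σpick S G)
      ≡⟨ +-assoc ((1ℤ + 0ℤ) * pathSum 𝟎 S) (Σpick S I) (Σpick S G) ⟨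
    insertSum f 𝟎 𝟎 0ℤ S + Σpick S (λ t S′ → g t * insertSum f (b t) 𝟎 0ℤ S′)
      ≡⟨ insertSum-expand f g 𝟎 0ℤ S ⟨
    insertSum f g 𝟎 0ℤ S ∎
    where
    open ≡-Reasoning
    I G : V → Vec V k → ℤ
    I t S′ = (1ℤ + 0ℤ) * insertSum f 𝟎 (b t) (f t) S′
    G t S′ = g t * insertSum f (b t) 𝟎 0ℤ S′
    ring : ∀ c r → (1ℤ * (1ℤ + c) - 1ℤ * c) * r ≡ (1ℤ + 0ℤ) * r
    ring = solve-∀
    ring₁ : ∀ g → 1ℤ * (1ℤ + g) ≡ 1ℤ + g * 1ℤ
    ring₁ = solve-∀
    ring₂ : ∀ g → 1ℤ * g ≡ 0ℤ + g * 1ℤ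
    ring₂ = solve-∀

-- Sums and products over lists

Unique-resp-↭ : {xs ys : List A} → xs ↭ ys → Unique xs → Unique ys
Unique-resp-↭ p = PermSetoid.Unique-resp-↭ (setoid _) (↭⇒↭ₛ p)

Unique-++⁻ˡ : ∀ (xs : List A) {ys} → Unique (xs ++ ys) → Unique xs
Unique-++⁻ˡ []       _        = []
Unique-++⁻ˡ (x ∷ xs) (p ∷ ps) = All.tabulate (λ m → All.lookup p (∈-++⁺ˡ m)) ∷ Unique-++⁻ˡ xs ps

Unique-++⁻ʳ : ∀ (xs : List A) {ys} → Unique (xs ++ ys) → Unique ys
Unique-++⁻ʳ []       u        = u
Unique-++⁻ʳ (x ∷ xs) (_ ∷ us) = Unique-++⁻ʳ xs us

Unique-map-injective : (f : A → B) {xs : List A} → Unique (map f xs) →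
  ∀ {x y} → x ∈ xs → y ∈ xs → f x ≡ f y → x ≡ y
Unique-map-injective f (p ∷ ps) (here refl) (here refl) e = refl
Unique-map-injective f (p ∷ ps) (here refl) (there m)   e =
  ⊥-elim (All.lookup p (∈-map⁺ f m) e)
Unique-map-injective f (p ∷ ps) (there m)   (here refl) e =
  ⊥-elim (All.lookup p (∈-map⁺ f m) (sym e))
Unique-map-injective f (p ∷ ps) (there l)   (there m)   e = Unique-map-injective f ps l m e

and-map⁺ : (p : A → Bool) (xs : List A) → (∀ {x} → x ∈ xs → p x ≡ true) → and (map p xs) ≡ true
and-map⁺ p []       h = refl
and-map⁺ p (x ∷ xs) h rewrite h (here refl) = and-map⁺ p xs (h ∘ there)

and-map⁻ : (p : A → Bool) (xs : List A) → and (map p xs) ≡ true → ∀ {x} → x ∈ xs → p x ≡ true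
and-map⁻ p (x ∷ xs) e m with p x in px
and-map⁻ p (x ∷ xs) e (here refl) | true = px
and-map⁻ p (x ∷ xs) e (there m)   | true = and-map⁻ p xs e m

and-map-false⁻ : (p : A → Bool) (xs : List A) → and (map p xs) ≡ false → ∃ λ x → p x ≡ false
and-map-false⁻ p (x ∷ xs) e with p x in px
... | true  = and-map-false⁻ p xs e
... | false = x , px

and-map-false⁺ : (p : A → Bool) (xs : List A) → ∀ {x} → x ∈ xs → p x ≡ false →
  and (map p xs) ≡ false
and-map-false⁺ p (x ∷ xs) (here refl) e rewrite e = refl
and-map-false⁺ p (x ∷ xs) (there m)   e with p x
... | true  = and-map-false⁺ p xs m e
... | false = refl

∀Fin⁺ : ∀ {n} {p : Fin n → Bool} → (∀ i → p i ≡ true) → ∀Fin n p ≡ true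
∀Fin⁺ {n} {p} h = and-map⁺ p (allFin n) (λ {i} _ → h i)

∀Fin⁻ : ∀ {n} {p : Fin n → Bool} → ∀Fin n p ≡ true → ∀ i → p i ≡ true
∀Fin⁻ {n} {p} e i = and-map⁻ p (allFin n) e (∈-allFin i)

∑ : List A → (A → ℤ) → ℤ
∑ xs f = foldr _+_ 0ℤ (map f xs)

∏ : List A → (A → ℤ) → ℤ
∏ xs f = foldr _*_ 1ℤ (map f xs)

∑-cong : (xs : List A) {f g : A → ℤ} → (∀ x → f x ≡ g x) → ∑ xs f ≡ ∑ xs g
∑-cong []       e = refl
∑-cong (x ∷ xs) e = cong₂ _+_ (e x) (∑-cong xs e)

∑-zero : (xs : List A) {f : A → ℤ} → (∀ {x} → x ∈ xs → f x ≡ 0ℤ) → ∑ xs f ≡ 0ℤ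
∑-zero []       e = refl
∑-zero (x ∷ xs) e = cong₂ _+_ (e (here refl)) (∑-zero xs (e ∘ there))

∑-+ : (xs : List A) (f g : A → ℤ) → ∑ xs (λ x → f x + g x) ≡ ∑ xs f + ∑ xs g
∑-+ []       f g = refl
∑-+ (x ∷ xs) f g =
  trans (cong (f x + g x +_) (∑-+ xs f g)) (+-interchange (f x) (g x) (∑ xs f) (∑ xs g))

∑-*ˡ : (xs : List A) (c : ℤ) (f : A → ℤ) → ∑ xs (λ x → c * f x) ≡ c * ∑ xs f
∑-*ˡ []       c f = sym (*-zeroʳ c)
∑-*ˡ (x ∷ xs) c f = trans (cong (c * f x +_) (∑-*ˡ xs c f)) (sym (*-distribˡ-+ c (f x) (∑ xs f)))

∑-++ : (xs ys : List A) (f : A → ℤ) → ∑ (xs ++ ys) f ≡ ∑ xs f + ∑ ys f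
∑-++ []       ys f = sym (+-identityˡ _)
∑-++ (x ∷ xs) ys f = trans (cong (f x +_) (∑-++ xs ys f)) (sym (+-assoc (f x) (∑ xs f) (∑ ys f)))

∑-↭ : {xs ys : List A} (f : A → ℤ) → xs ↭ ys → ∑ xs f ≡ ∑ ys f
∑-↭ f p = PermSetoid.foldr-commMonoid (setoid ℤ) +-0-isCommutativeMonoid (↭⇒↭ₛ (Perm.map⁺ f p))

∑-map : (g : A → B) (xs : List A) (f : B → ℤ) → ∑ (map g xs) f ≡ ∑ xs (f ∘ g)
∑-map g xs f = cong (foldr _+_ 0ℤ) (sym (map-∘ xs))

∑-concatMap : (g : A → List B) (xs : List A) (f : B → ℤ) →
  ∑ (concatMap g xs) f ≡ ∑ xs (λ x → ∑ (g x) f)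
∑-concatMap g []       f = refl
∑-concatMap g (x ∷ xs) f =
  trans (∑-++ (g x) (concatMap g xs) f) (cong (∑ (g x) f +_) (∑-concatMap g xs f))

∑-comm : (xs : List A) (ys : List B) (f : A → B → ℤ) →
  ∑ xs (λ x → ∑ ys (f x)) ≡ ∑ ys (λ y → ∑ xs (λ x → f x y))
∑-comm []       ys f = sym (∑-zero ys (λ _ → refl))
∑-comm (x ∷ xs) ys f = trans (cong (∑ ys (f x) +_) (∑-comm xs ys f)) (sym (∑-+ ys (f x) _))

∑-filterᵇ : (p : A → Bool) (xs : List A) (f : A → ℤ) →
  ∑ (filterᵇ p xs) f ≡ ∑ xs (λ x → if p x then f x else 0ℤ)
∑-filterᵇ p []       f = refl
∑-filterᵇ p (x ∷ xs) f with p x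
... | true  = cong (f x +_) (∑-filterᵇ p xs f)
... | false = trans (∑-filterᵇ p xs f) (sym (+-identityˡ _))

length≡∑1 : (xs : List A) → ℤ.+ length xs ≡ ∑ xs (λ _ → 1ℤ)
length≡∑1 []       = refl
length≡∑1 (x ∷ xs) = cong (1ℤ +_) (length≡∑1 xs)

∏-++ : (xs ys : List A) (f : A → ℤ) → ∏ (xs ++ ys) f ≡ ∏ xs f * ∏ ys f
∏-++ []       ys f = sym (*-identityˡ _)
∏-++ (x ∷ xs) ys f = trans (cong (f x *_) (∏-++ xs ys f)) (sym (*-assoc (f x) (∏ xs f) (∏ ys f)))

∏-↭ : {xs ys : List A} (f : A → ℤ) → xs ↭ ys → ∏ xs f ≡ ∏ ys f
∏-↭ f p = PermSetoid.foldr-commMonoid (setoid ℤ) *-1-isCommutativeMonoid (↭⇒↭ₛ (Perm.map⁺ f p))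

∏-map : (g : A → B) (xs : List A) (f : B → ℤ) → ∏ (map g xs) f ≡ ∏ xs (f ∘ g)
∏-map g xs f = cong (foldr _*_ 1ℤ) (sym (map-∘ xs))

∏-one : (xs : List A) {f : A → ℤ} → (∀ {x} → x ∈ xs → f x ≡ 1ℤ) → ∏ xs f ≡ 1ℤ
∏-one []       e = refl
∏-one (x ∷ xs) e = cong₂ _*_ (e (here refl)) (∏-one xs (e ∘ there))

-- Sums over all vertices and over all functions

allFin-suc : ∀ n → allFin (suc n) ≡ zero ∷ map suc (allFin n)
allFin-suc n = cong (zero ∷_) (sym (map-tabulate (λ i → i) suc))

∑-allFin-suc : ∀ n (f : Fin (suc n) → ℤ) → ∑ (allFin (suc n)) f ≡ f zero + ∑ (allFin n) (f ∘ suc)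
∑-allFin-suc n f = trans (cong (λ xs → ∑ xs f) (allFin-suc n))
  (cong (f zero +_) (∑-map suc (allFin n) f))

∏-allFin-suc : ∀ n (f : Fin (suc n) → ℤ) → ∏ (allFin (suc n)) f ≡ f zero * ∏ (allFin n) (f ∘ suc)
∏-allFin-suc n f = trans (cong (λ xs → ∏ xs f) (allFin-suc n))
  (cong (f zero *_) (∏-map suc (allFin n) f))

δ : ∀ {n} → Fin n → Fin n → ℤ
δ i j = if does (i Fin.≟ j) then 1ℤ else 0ℤ

δ-≡ : ∀ {n} {i j : Fin n} → i ≡ j → δ i j ≡ 1ℤ
δ-≡ {i = i} {j} e with i Fin.≟ j
... | yes _ = refl
... | no ¬e = ⊥-elim (¬e e)

δ-≢ : ∀ {n} {i j : Fin n} → i ≢ j → δ i j ≡ 0ℤ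
δ-≢ {i = i} {j} ¬e with i Fin.≟ j
... | yes e = ⊥-elim (¬e e)
... | no _  = refl

∑-δ : ∀ {n} (s : Fin n) (f : Fin n → ℤ) → ∑ (allFin n) (λ t → δ t s * f t) ≡ f s
∑-δ {suc n} zero f = trans (∑-allFin-suc n (λ t → δ t zero * f t))
  (trans (cong₂ _+_ (*-identityˡ (f zero)) (∑-zero (allFin n) (λ {t} _ → *-zeroˡ (f (suc t)))))
    (+-identityʳ (f zero)))
∑-δ {suc n} (suc s) f = trans (∑-allFin-suc n (λ t → δ t (suc s) * f t))
  (trans (cong₂ _+_ (*-zeroˡ (f zero)) (∑-δ s (f ∘ suc))) (+-identityˡ (f (suc s))))

∑-allFuns-suc : ∀ n m (F : (Fin (suc n) → Fin m) → ℤ) →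
  ∑ (allFuns (suc n) m) F ≡ ∑ (allFuns n m) (λ f → ∑ (allFin m) (λ x → F (x ◂ f)))
∑-allFuns-suc n m F = trans (∑-concatMap _ (allFuns n m) F)
  (∑-cong (allFuns n m) (λ f → ∑-map (λ x → x ◂ f) (allFin m) F))

-- Counts the occurrences of `ρ` up to pointwise equality, which avoids function extensionality;
-- `∑-δ` sums out one value at a time.
∑-allFuns-δ : ∀ {n m} (ρ : Fin n → Fin m) →
  ∑ (allFuns n m) (λ σ → ∏ (allFin n) (λ i → δ (σ i) (ρ i))) ≡ 1ℤ
∑-allFuns-δ {zero}      ρ = refl
∑-allFuns-δ {suc n} {m} ρ = begin
  ∑ (allFuns (suc n) m) (λ σ → ∏ (allFin (suc n)) (λ i → δ (σ i) (ρ i)))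
    ≡⟨ ∑-allFuns-suc n m _ ⟩
  ∑ (allFuns n m) (λ f → ∑ (allFin m) (λ x → ∏ (allFin (suc n)) (λ i → δ ((x ◂ f) i) (ρ i))))
    ≡⟨ ∑-cong (allFuns n m) (λ f → trans
         (∑-cong (allFin m) (λ x → ∏-allFin-suc n (λ i → δ ((x ◂ f) i) (ρ i))))
         (∑-δ (ρ zero) (λ _ → ∏ (allFin n) (λ i → δ (f i) (ρ (suc i)))))) ⟩
  ∑ (allFuns n m) (λ f → ∏ (allFin n) (λ i → δ (f i) (ρ (suc i))))
    ≡⟨ ∑-allFuns-δ (ρ ∘ suc) ⟩
  1ℤ ∎
  where open ≡-Reasoning

-- Functions with prescribed values

Arc : ℕ → Set
Arc n = Fin n × Fin n

Follows : ∀ {n} → (Fin n → Fin n) → Arc n → Set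
Follows σ (u , v) = σ u ≡ v

-- The indicator of `All (Follows σ) L`, as a product so that it ignores the order of the arcs and
-- lets a single value of `σ` be summed out.
follows : ∀ {n} → List (Arc n) → (Fin n → Fin n) → ℤ
follows L σ = ∏ L (λ (u , v) → δ v (σ u))

follows-cases : ∀ {n} (L : List (Arc n)) σ →
  (All (Follows σ) L × follows L σ ≡ 1ℤ) ⊎ follows L σ ≡ 0ℤ
follows-cases [] σ = inj₁ ([] , refl)
follows-cases ((u , v) ∷ L) σ with v Fin.≟ σ u | follows-cases L σ
... | no _  | _             = inj₂ refl
... | yes e | inj₂ z        = inj₂ (trans (*-identityˡ _) z)
... | yes e | inj₁ (p , o)  = inj₁ (sym e ∷ p , trans (*-identityˡ _) o)

follows-All : ∀ {n} (L : List (Arc n)) σ → All (Follows σ) L → follows L σ ≡ 1ℤ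
follows-All L σ p = ∏-one L (λ m → δ-≡ (sym (All.lookup p m)))

≡⇒≡ᶠ : ∀ {n} (i j : Fin n) → i ≡ j → (i ≡ᶠ j) ≡ true
≡⇒≡ᶠ zero    zero    e = refl
≡⇒≡ᶠ (suc i) (suc j) e = ≡⇒≡ᶠ i j (Fin.suc-injective e)

≡ᶠ⇒≡ : ∀ {n} (i j : Fin n) → (i ≡ᶠ j) ≡ true → i ≡ j
≡ᶠ⇒≡ zero    zero    e = refl
≡ᶠ⇒≡ (suc i) (suc j) e = cong suc (≡ᶠ⇒≡ i j e)

isInjective⁺ : ∀ {n} (σ : Fin n → Fin n) → (∀ i j → σ i ≡ σ j → i ≡ j) → isInjective σ ≡ true
isInjective⁺ σ inj = ∀Fin⁺ λ i → ∀Fin⁺ (lem i)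
  where
  lem : ∀ i j → (not (σ i ≡ᶠ σ j) ∨ (i ≡ᶠ j)) ≡ true
  lem i j with σ i ≡ᶠ σ j in e
  ... | false = refl
  ... | true  = ≡⇒≡ᶠ i j (inj i j (≡ᶠ⇒≡ (σ i) (σ j) e))

isInjective⁻ : ∀ {n} (σ : Fin n → Fin n) → isInjective σ ≡ true → ∀ i j → σ i ≡ σ j → i ≡ j
isInjective⁻ σ t i j e
  with σ i ≡ᶠ σ j in q
     | ∀Fin⁻ (∀Fin⁻ {p = λ i → ∀Fin _ λ j → not (σ i ≡ᶠ σ j) ∨ (i ≡ᶠ j)} t i) j
... | true  | r = ≡ᶠ⇒≡ i j r
... | false | _ with () ← trans (sym q) (≡⇒≡ᶠ (σ i) (σ j) e)

module ArcSums {n : ℕ} (W : (Fin n → Fin n) → ℤ)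
  (W-injective : ∀ σ → isInjective σ ≡ false → W σ ≡ 0ℤ) where

  -- A permutation is summed over by fixing its values one at a time, in an order that depends on
  -- the values already fixed.
  arcSum : List (Arc n) → ℤ
  arcSum L = ∑ (allFuns n n) (λ σ → follows L σ * W σ)

  arcSum-↭ : ∀ {L L′} → L ↭ L′ → arcSum L ≡ arcSum L′
  arcSum-↭ p = ∑-cong (allFuns n n) (λ σ → cong (_* W σ) (∏-↭ _ p))

  -- Exactly one `t` equals `σ u`, so the deltas for the new arc add up to 1.
  arcSum-split : ∀ u L → arcSum L ≡ ∑ (allFin n) (λ t → arcSum ((u , t) ∷ L))
  arcSum-split u L = sym (trans (∑-comm (allFin n) (allFuns n n) _) (∑-cong (allFuns n n) (λ σ →
    trans (∑-cong (allFin n) (λ t → *-assoc (δ t (σ u)) (follows L σ) (W σ)))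
      (∑-δ (σ u) (λ _ → follows L σ * W σ)))))

  -- A function following these arcs takes the value `t` both at `u` and at the source of another
  -- arc; it is not injective, so its weight vanishes.
  arcSum-clash : ∀ u t L → t ∈ map proj₂ L → u ∉ map proj₁ L → arcSum ((u , t) ∷ L) ≡ 0ℤ
  arcSum-clash u t L t∈ u∉ = ∑-zero (allFuns n n) (λ {σ} _ → term σ)
    where
    term : ∀ σ → follows ((u , t) ∷ L) σ * W σ ≡ 0ℤ
    term σ with follows-cases ((u , t) ∷ L) σ
    ... | inj₂ z = trans (cong (_* W σ) z) (*-zeroˡ (W σ))
    ... | inj₁ (σu≡t ∷ p , _) with isInjective σ in inj | ∈-map⁻ proj₂ t∈
    ... | false | _ = trans (cong (follows ((u , t) ∷ L) σ *_) (W-injective σ inj))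
            (*-zeroʳ (follows ((u , t) ∷ L) σ))
    ... | true  | (s , .t) , m , refl = ⊥-elim (u∉ (subst (_∈ map proj₁ L)
            (isInjective⁻ σ inj s u (trans (All.lookup p m) (sym σu≡t))) (∈-map⁺ proj₁ m)))

  -- Each vertex is the source of exactly one arc, so `L` is the graph of a function `ρ`, met once
  -- in the enumeration up to pointwise equality.
  arcSum-total : ∀ L w → Unique (map proj₁ L) → (∀ i → i ∈ map proj₁ L) →
    (∀ σ → All (Follows σ) L → W σ ≡ w) → arcSum L ≡ w
  arcSum-total L w uniq total val = begin
    arcSum L
      ≡⟨ ∑-cong (allFuns n n) term ⟩
    ∑ (allFuns n n) (λ σ → w * ∏ (allFin n) (λ i → δ (σ i) (ρ i)))
      ≡⟨ ∑-*ˡ (allFuns n n) w _ ⟩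
    w * ∑ (allFuns n n) (λ σ → ∏ (allFin n) (λ i → δ (σ i) (ρ i)))
      ≡⟨ cong (w *_) (∑-allFuns-δ ρ) ⟩
    w * 1ℤ
      ≡⟨ *-identityʳ w ⟩
    w ∎
    where
    open ≡-Reasoning
    ρ : Fin n → Fin n
    ρ i = proj₂ (proj₁ (∈-map⁻ proj₁ (total i)))
    ρ-∈ : ∀ i → (i , ρ i) ∈ L
    ρ-∈ i with (.i , v) , m , refl ← ∈-map⁻ proj₁ (total i) = m
    graph : Fin n → Arc n
    graph i = i , ρ i
    ρ-follows : ∀ {a} → a ∈ L → ρ (proj₁ a) ≡ proj₂ a
    ρ-follows {a} m = cong proj₂ (Unique-map-injective proj₁ uniq (ρ-∈ (proj₁ a)) m refl)
    term : ∀ σ → follows L σ * W σ ≡ w * ∏ (allFin n) (λ i → δ (σ i) (ρ i))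
    term σ with follows-cases L σ | follows-cases (map graph (allFin n)) σ
    ... | inj₁ (p , o) | _ = trans (cong₂ _*_ o (val σ p)) (trans (*-comm 1ℤ w)
          (cong (w *_) (sym (∏-one (allFin n) (λ {i} _ → δ-≡ (All.lookup p (ρ-∈ i)))))))
    -- A `σ` that agrees with `ρ` everywhere follows every arc of `L`, so the two indicators cannot
    -- differ in this way.
    ... | inj₂ z | inj₁ (p , _) with () ← trans (sym z) (follows-All L σ (All.tabulate λ {a} m →
          trans (All.lookup p (∈-map⁺ graph (∈-allFin (proj₁ a)))) (ρ-follows m)))
    ... | inj₂ z | inj₂ z′ = trans (cong (_* W σ) z) (trans (*-zeroˡ (W σ)) (sym
          (trans (cong (w *_) (trans (swapδ (allFin n)) z′)) (*-zeroʳ w))))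
      where
      δ-sym : ∀ i j → δ {n} i j ≡ δ j i
      δ-sym i j with i Fin.≟ j
      ... | yes refl = sym (δ-≡ {i = i} refl)
      ... | no ¬e    = sym (δ-≢ (¬e ∘ sym))
      swapδ : ∀ is → ∏ is (λ i → δ (σ i) (ρ i)) ≡ follows (map graph is) σ
      swapδ []       = refl
      swapδ (i ∷ is) = cong₂ _*_ (δ-sym (σ i) (ρ i)) (swapδ is)

-- Hamiltonian paths as arrangements

∑-Σpick : (xs : List A) (S : Vec V (suc k)) (F : A → V → Vec V k → ℤ) →
  ∑ xs (λ x → Σpick S (F x)) ≡ Σpick S (λ t S′ → ∑ xs (λ x → F x t S′))
∑-Σpick xs (t ∷ [])         F = refl
∑-Σpick xs (t ∷ S@(_ ∷ _)) F = trans (∑-+ xs (λ x → F x t S) _)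
  (cong (∑ xs (λ x → F x t S) +_) (∑-Σpick xs S (λ x s S′ → F x s (t ∷ S′))))

Σpick-toList : (S : Vec V (suc k)) (f : V → ℤ) → Σpick S (λ t _ → f t) ≡ ∑ (toList S) f
Σpick-toList (x ∷ [])         f = sym (+-identityʳ (f x))
Σpick-toList (x ∷ S@(_ ∷ _)) f = cong (f x +_) (Σpick-toList S f)

Σpick-zero : (S : Vec V (suc k)) {F : V → Vec V k → ℤ} →
  (∀ {t S′} → Pick S t S′ → F t S′ ≡ 0ℤ) → Σpick S F ≡ 0ℤ
Σpick-zero (x ∷ [])        e = e here
Σpick-zero (x ∷ S@(_ ∷ _)) e = cong₂ _+_ (e here) (Σpick-zero S (e ∘ there))

Pick-↭ : {S : Vec V (suc k)} {t : V} {S′ : Vec V k} → Pick S t S′ → toList S ↭ t ∷ toList S′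
Pick-↭ here      = ↭-refl
Pick-↭ (there p) = ↭-trans (prep _ (Pick-↭ p)) (swap _ _ ↭-refl)

∈⇒Pick : {S : Vec V (suc k)} {t : V} → t ∈ toList S → ∃ (Pick S t)
∈⇒Pick {S = x ∷ S}         (here refl) = S , here
∈⇒Pick {S = x ∷ S@(_ ∷ _)} (there m) with S′ , p ← ∈⇒Pick {S = S} m = x ∷ S′ , there p

Pick-∈ : {S : Vec V (suc k)} {t : V} {S′ : Vec V k} → Pick S t S′ → t ∈ toList S
Pick-∈ p = Perm.∈-resp-↭ (↭-sym (Pick-↭ p)) (here refl)

Pick-⊆ : {S : Vec V (suc k)} {t s : V} {S′ : Vec V k} → Pick S t S′ → s ∈ toList S′ → s ∈ toList S
Pick-⊆ p m = Perm.∈-resp-↭ (↭-sym (Pick-↭ p)) (there m)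

Pick-Unique : {S : Vec V (suc k)} {t : V} {S′ : Vec V k} →
  Pick S t S′ → Unique (toList S) → Unique (t ∷ toList S′)
Pick-Unique p = Unique-resp-↭ (Pick-↭ p)

Σpick-δ : ∀ {n} {S : Vec (Fin n) (suc k)} {t S₀} (F : Fin n → Vec (Fin n) k → ℤ) →
  Unique (toList S) → Pick S t S₀ → Σpick S (λ s S′ → δ t s * F s S′) ≡ F t S₀
Σpick-δ {t = t} F u (here {S = []}) =
  trans (cong (_* F t []) (δ-≡ {i = t} refl)) (*-identityˡ _)
Σpick-δ {t = t} F (t∉ ∷ u) (here {S = S@(_ ∷ _)}) = trans
  (cong₂ _+_ (trans (cong (_* F t S) (δ-≡ {i = t} refl)) (*-identityˡ (F t S)))
    (Σpick-zero S (λ {s} {S′} p → trans (cong (_* F s (t ∷ S′)) (δ-≢ (All.lookup t∉ (Pick-∈ p))))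
      (*-zeroˡ (F s (t ∷ S′))))))
  (+-identityʳ (F t S))
Σpick-δ {t = t} F (x∉ ∷ u) (there {x = x} {S = S@(_ ∷ _)} p) = trans
  (cong₂ _+_ (trans (cong (_* F x S) (δ-≢ (λ t≡x → All.lookup x∉ (Pick-∈ p) (sym t≡x))))
      (*-zeroˡ (F x S)))
    (Σpick-δ (λ s S′ → F s (x ∷ S′)) u p))
  (+-identityˡ _)

-- For S without repetitions: 1 if f is an arrangement of S, and 0 otherwise.
enumerates : ∀ {n k} → Vec (Fin n) k → (Fin k → Fin n) → ℤ
enumerates {k = zero}  S f = 1ℤ
enumerates {k = suc k} S f = Σpick S λ t S′ → δ (f zero) t * enumerates S′ (f ∘ suc)

-- The first value determines the pick; injectivity keeps the later values in the remainder.
enumerates-injective : ∀ {n k} (S : Vec (Fin n) k) (f : Fin k → Fin n) → Unique (toList S) →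
  (∀ i j → f i ≡ f j → i ≡ j) → (∀ i → f i ∈ toList S) → enumerates S f ≡ 1ℤ
enumerates-injective {k = zero}  S f u inj mem = refl
enumerates-injective {k = suc k} S f u inj mem with S₀ , p ← ∈⇒Pick {S = S} (mem zero) =
  trans (Σpick-δ (λ _ S′ → enumerates S′ (f ∘ suc)) u p)
    (enumerates-injective S₀ (f ∘ suc) (AllPairs.tail (Pick-Unique p u))
      (λ i j e → Fin.suc-injective (inj (suc i) (suc j) e)) mem′)
  where
  mem′ : ∀ i → f (suc i) ∈ toList S₀
  mem′ i with Perm.∈-resp-↭ (Pick-↭ p) (mem (suc i))
  ... | there m = m
  ... | here e with () ← inj (suc i) zero e

enumerates-∉ : ∀ {n k} (S : Vec (Fin n) k) (f : Fin k → Fin n) i → f i ∉ toList S →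
  enumerates S f ≡ 0ℤ
enumerates-∉ {k = suc k} S f zero ∉S = Σpick-zero S λ {t} {S′} p →
  cong (_* enumerates S′ (f ∘ suc)) (δ-≢ λ e → ∉S (subst (_∈ toList S) (sym e) (Pick-∈ p)))
enumerates-∉ {k = suc k} S f (suc i) ∉S = Σpick-zero S λ {t} {S′} p →
  trans (cong (δ (f zero) t *_) (enumerates-∉ S′ (f ∘ suc) i (∉S ∘ Pick-⊆ p)))
    (*-zeroʳ (δ (f zero) t))

-- A pick equal to `f zero` removes that value from `S`, so it is no longer available at `suc j`.
enumerates-repeat₀ : ∀ {n k} (S : Vec (Fin n) (suc k)) (f : Fin (suc k) → Fin n) →
  Unique (toList S) → ∀ j → f zero ≡ f (suc j) → enumerates S f ≡ 0ℤ
enumerates-repeat₀ S f u j e = Σpick-zero S term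
  where
  term : ∀ {t S′} → Pick S t S′ → δ (f zero) t * enumerates S′ (f ∘ suc) ≡ 0ℤ
  term {t} {S′} p with f zero Fin.≟ t
  ... | no _     = refl
  ... | yes refl = trans (*-identityˡ _) (enumerates-∉ S′ (f ∘ suc) j
          (λ m → Unique[x∷xs]⇒x∉xs (Pick-Unique p u) (subst (_∈ toList S′) (sym e) m)))

enumerates-repeat : ∀ {n k} (S : Vec (Fin n) k) (f : Fin k → Fin n) → Unique (toList S) →
  ∀ i j → f i ≡ f j → i ≢ j → enumerates S f ≡ 0ℤ
enumerates-repeat S f u zero    zero    e ne = ⊥-elim (ne refl)
enumerates-repeat S f u zero    (suc j) e ne = enumerates-repeat₀ S f u j e
enumerates-repeat S f u (suc i) zero    e ne = enumerates-repeat₀ S f u i (sym e)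
enumerates-repeat S f u (suc i) (suc j) e ne = Σpick-zero S λ {t} {S′} p →
  trans (cong (δ (f zero) t *_) (enumerates-repeat S′ (f ∘ suc) (AllPairs.tail (Pick-Unique p u))
      i j e (ne ∘ cong suc)))
    (*-zeroʳ (δ (f zero) t))

toList-allFin : ∀ n → toList (Vec.allFin n) ≡ allFin n
toList-allFin n = go (λ i → i)
  where
  go : ∀ {k} (f : Fin k → V) → toList (Vec.tabulate f) ≡ tabulate f
  go {k = zero}  f = refl
  go {k = suc k} f = cong (f zero ∷_) (go (f ∘ suc))

toList-allFin-Unique : ∀ n → Unique (toList (Vec.allFin n))
toList-allFin-Unique n = subst Unique (sym (toList-allFin n)) (allFin⁺ n)

not-isInjective : ∀ {n} (σ : Fin n → Fin n) → isInjective σ ≡ false →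
  ∃ λ i → ∃ λ j → σ i ≡ σ j × i ≢ j
not-isInjective {n} σ e
  with i , e₁ ← and-map-false⁻ (λ i → ∀Fin n λ j → not (σ i ≡ᶠ σ j) ∨ (i ≡ᶠ j)) (allFin n) e
  with j , e₂ ← and-map-false⁻ (λ j → not (σ i ≡ᶠ σ j) ∨ (i ≡ᶠ j)) (allFin n) e₁
  with σ i ≡ᶠ σ j in e₃
... | true = i , j , ≡ᶠ⇒≡ (σ i) (σ j) e₃ ,
      λ i≡j → case (trans (sym e₂) (≡⇒≡ᶠ i j i≡j))
  where
  case : false ≢ true
  case ()

-- Turns the Boolean test into a sum that unfolds one value at a time, in step with `pathSum`.
enumerates-allFin : ∀ {n} (σ : Fin n → Fin n) →
  enumerates (Vec.allFin n) σ ≡ (if isInjective σ then 1ℤ else 0ℤ)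
enumerates-allFin {n} σ with isInjective σ in e
... | true  = enumerates-injective (Vec.allFin n) σ (toList-allFin-Unique n) (isInjective⁻ σ e)
      (λ i → subst (σ i ∈_) (sym (toList-allFin n)) (∈-allFin (σ i)))
... | false with i , j , eq , ne ← not-isInjective σ e =
      enumerates-repeat (Vec.allFin n) σ (toList-allFin-Unique n) i j eq ne

-- Chosen so that 1 + b is the indicator of the arcs of `complement D`.
arcWeight : ∀ {n} → Digraph n → Fin n → Fin n → ℤ
arcWeight D u v = if D u v then -1ℤ else 0ℤ

module HampCount {n : ℕ} (D : Digraph n) where
  open WeightedSums (arcWeight D)

  pathWeight : (Fin n → ℤ) → (Fin k → Fin n) → ℤ
  pathWeight {zero}  g f = 1ℤ
  pathWeight {suc k} g f = (1ℤ + g (f zero)) * pathWeight (arcWeight D (f zero)) (f ∘ suc)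

  -- The function gives up its value at `zero` while `S` gives up a pick; the delta between them is
  -- summed out by `∑-δ`.
  ∑-enumerates : (g : Fin n → ℤ) (S : Vec (Fin n) k) →
    ∑ (allFuns k n) (λ f → enumerates S f * pathWeight g f) ≡ pathSum g S
  ∑-enumerates {zero}  g S = refl
  ∑-enumerates {suc k} g S = begin
    ∑ (allFuns (suc k) n) (λ f → enumerates S f * pathWeight g f)
      ≡⟨ ∑-allFuns-suc k n _ ⟩
    ∑ (allFuns k n) (λ f → ∑ (allFin n) (λ x →
      Σpick S (λ t S′ → δ x t * enumerates S′ f) * step x f))
      ≡⟨ ∑-cong (allFuns k n) (λ f → trans
           (∑-cong (allFin n) (λ x → trans (*-comm _ (step x f))
             (sym (Σpick-* S (step x f) (λ t S′ → δ x t * enumerates S′ f)))))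
           (trans (∑-Σpick (allFin n) S (λ x t S′ → step x f * (δ x t * enumerates S′ f)))
             (Σpick-cong S (λ t S′ → trans
               (∑-cong (allFin n) (λ x → *-leftComm (step x f) (δ x t) (enumerates S′ f)))
               (∑-δ t (λ x → step x f * enumerates S′ f)))))) ⟩
    ∑ (allFuns k n) (λ f → Σpick S (λ t S′ → step t f * enumerates S′ f))
      ≡⟨ ∑-Σpick (allFuns k n) S (λ f t S′ → step t f * enumerates S′ f) ⟩
    Σpick S (λ t S′ → ∑ (allFuns k n) (λ f → step t f * enumerates S′ f))
      ≡⟨ Σpick-cong S (λ t S′ → begin
           ∑ (allFuns k n) (λ f → step t f * enumerates S′ f)
             ≡⟨ ∑-cong (allFuns k n) (λ f →
                  *-rotate (1ℤ + g t) (pathWeight (arcWeight D t) f) (enumerates S′ f)) ⟩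
           ∑ (allFuns k n) (λ f → (1ℤ + g t) * (enumerates S′ f * pathWeight (arcWeight D t) f))
             ≡⟨ ∑-*ˡ (allFuns k n) (1ℤ + g t) _ ⟩
           (1ℤ + g t) * ∑ (allFuns k n) (λ f → enumerates S′ f * pathWeight (arcWeight D t) f)
             ≡⟨ cong ((1ℤ + g t) *_) (∑-enumerates (arcWeight D t) S′) ⟩
           (1ℤ + g t) * pathSum (arcWeight D t) S′ ∎) ⟩
    Σpick S (λ t S′ → (1ℤ + g t) * pathSum (arcWeight D t) S′) ∎
    where
    open ≡-Reasoning
    step : Fin n → (Fin k → Fin n) → ℤ
    step x f = (1ℤ + g x) * pathWeight (arcWeight D x) f
    *-rotate : ∀ a b c → (a * b) * c ≡ a * (c * b)
    *-rotate = solve-∀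

  -- Every factor is 1 + 0. The condition on `g` concerns only the first vertex; this form of it
  -- also makes sense for `k = 0`.
  pathWeight-one : (g : Fin n → ℤ) (f : Fin k → Fin n) →
    (∀ i → toℕ i ≡ 0 → g (f i) ≡ 0ℤ) →
    (∀ i j → toℕ j ≡ suc (toℕ i) → D (f i) (f j) ≡ false) → pathWeight g f ≡ 1ℤ
  pathWeight-one {zero}  g f g0 arcs = refl
  pathWeight-one {suc k} g f g0 arcs = cong₂ (λ p q → (1ℤ + p) * q) (g0 zero refl)
    (pathWeight-one (arcWeight D (f zero)) (f ∘ suc)
      (λ i i≡0 → cong (λ d → if d then -1ℤ else 0ℤ) (arcs zero (suc i) (cong suc i≡0)))
      (λ i j e → arcs (suc i) (suc j) (cong suc e)))

  pathWeight-zero : (g : Fin n → ℤ) (f : Fin k → Fin n) →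
    ∀ i j → toℕ j ≡ suc (toℕ i) → D (f i) (f j) ≡ true → pathWeight g f ≡ 0ℤ
  pathWeight-zero g f zero (suc zero) e d = trans
    (cong (λ d → (1ℤ + g (f zero)) * ((1ℤ + (if d then -1ℤ else 0ℤ)) *
      pathWeight (arcWeight D (f (suc zero))) (λ i → f (suc (suc i))))) d)
    (*-zeroʳ (1ℤ + g (f zero)))
  pathWeight-zero g f (suc i) (suc j) e d = trans
    (cong ((1ℤ + g (f zero)) *_) (pathWeight-zero _ (f ∘ suc) i j (ℕ.suc-injective e) d))
    (*-zeroʳ (1ℤ + g (f zero)))

  -- With `isPath`, this names the second conjunct of `isHamp (complement D)`, so that the two agree
  -- by definition.
  arcIfNext : (Fin n → Fin n) → Fin n → Fin n → Bool
  arcIfNext v k l = not (toℕ l ℕ.≡ᵇ suc (toℕ k)) ∨ complement D (v k) (v l)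

  isPath : (Fin n → Fin n) → Bool
  isPath v = ∀Fin n λ k → ∀Fin n (arcIfNext v k)

  pathWeight-isPath : ∀ v → pathWeight 𝟎 v ≡ (if isPath v then 1ℤ else 0ℤ)
  pathWeight-isPath v with isPath v in e
  ... | true  = pathWeight-one 𝟎 v (λ _ _ → refl) arc
    where
    arc : ∀ i j → toℕ j ≡ suc (toℕ i) → D (v i) (v j) ≡ false
    arc i j next
      with ∀Fin⁻ {p = arcIfNext v i} (∀Fin⁻ {p = λ k → ∀Fin n (arcIfNext v k)} e i) j
    ... | t with toℕ j ℕ.≡ᵇ suc (toℕ i) | ℕ.≡⇒≡ᵇ (toℕ j) (suc (toℕ i)) next | D (v i) (v j)
    ... | true | _ | false = refl
  ... | false
    with i , e₁ ← and-map-false⁻ (λ k → ∀Fin n (arcIfNext v k)) (allFin n) e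
    with j , e₂ ← and-map-false⁻ (arcIfNext v i) (allFin n) e₁
    with toℕ j ℕ.≡ᵇ suc (toℕ i) | ℕ.≡ᵇ⇒≡ (toℕ j) (suc (toℕ i)) | D (v i) (v j) in d
  ... | true | next | true = pathWeight-zero 𝟎 v i j (next _) d

  length-hamps : ℤ.+ length (hamps (complement D)) ≡ pathSum 𝟎 (Vec.allFin n)
  length-hamps = begin
    ℤ.+ length (hamps (complement D))
      ≡⟨ length≡∑1 (hamps (complement D)) ⟩
    ∑ (hamps (complement D)) (λ _ → 1ℤ)
      ≡⟨ ∑-filterᵇ (isHamp (complement D)) (allFuns n n) _ ⟩
    ∑ (allFuns n n) (λ v → if isInjective v ∧ isPath v then 1ℤ else 0ℤ)
      ≡⟨ ∑-cong (allFuns n n) (λ v → trans (if-∧ (isInjective v) (isPath v))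
           (sym (cong₂ _*_ (enumerates-allFin v) (pathWeight-isPath v)))) ⟩
    ∑ (allFuns n n) (λ v → enumerates (Vec.allFin n) v * pathWeight 𝟎 v)
      ≡⟨ ∑-enumerates 𝟎 (Vec.allFin n) ⟩
    pathSum 𝟎 (Vec.allFin n) ∎
    where
    open ≡-Reasoning
    if-∧ : ∀ a b → (if a ∧ b then 1ℤ else 0ℤ) ≡
      (if a then 1ℤ else 0ℤ) * (if b then 1ℤ else 0ℤ)
    if-∧ true  true  = refl
    if-∧ true  false = refl
    if-∧ false _     = refl

-- Cycles of a permutation

pathArcs : V → List V → List (V × V)
pathArcs x []       = []
pathArcs x (y ∷ ys) = (x , y) ∷ pathArcs y ys

-- A cycle is stored as a starting vertex and the vertices after it; appending the start supplies
-- the closing arc.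
cycleArcs : V × List V → List (V × V)
cycleArcs (x , ys) = pathArcs x (ys ∷ʳ x)

end : V → List V → V
end x []       = x
end x (y ∷ ys) = end y ys

end-∷ʳ : ∀ (x : V) ys t → end x (ys ∷ʳ t) ≡ t
end-∷ʳ x []       t = refl
end-∷ʳ x (y ∷ ys) t = end-∷ʳ y ys t

-- A new arc enters an arc sum at the front of the list, but extends a path at its end.
pathArcs-∷ʳ : ∀ (x : V) ys t → (end x ys , t) ∷ pathArcs x ys ↭ pathArcs x (ys ∷ʳ t)
pathArcs-∷ʳ x []       t = ↭-refl
pathArcs-∷ʳ x (y ∷ ys) t = ↭-trans (swap _ _ ↭-refl) (prep _ (pathArcs-∷ʳ y ys t))

pathArcs-++ : ∀ (x : V) ys z zs → pathArcs x (ys ++ z ∷ zs) ≡ pathArcs x (ys ∷ʳ z) ++ pathArcs z zs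
pathArcs-++ x []       z zs = refl
pathArcs-++ x (y ∷ ys) z zs = cong ((x , y) ∷_) (pathArcs-++ y ys z zs)

sources-∷ʳ : ∀ (x : V) ys t → map proj₁ (pathArcs x (ys ∷ʳ t)) ≡ x ∷ ys
sources-∷ʳ x []       t = refl
sources-∷ʳ x (y ∷ ys) t = cong (x ∷_) (sources-∷ʳ y ys t)

targets : ∀ (x : V) ys → map proj₂ (pathArcs x ys) ≡ ys
targets x []       = refl
targets x (y ∷ ys) = cong (y ∷_) (targets y ys)

-- Cutting at `x` and `y` gives the same two paths, listed in opposite orders.
cycleArcs-rotate : ∀ (x : V) as y bs → cycleArcs (y , bs ++ x ∷ as) ↭ cycleArcs (x , as ++ y ∷ bs)
cycleArcs-rotate x as y bs = begin
  pathArcs y ((bs ++ x ∷ as) ∷ʳ y)              ≡⟨ split y bs x as ⟩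
  pathArcs y (bs ∷ʳ x) ++ pathArcs x (as ∷ʳ y)  ↭⟨ Perm.++-comm (pathArcs y (bs ∷ʳ x)) _ ⟩
  pathArcs x (as ∷ʳ y) ++ pathArcs y (bs ∷ʳ x)  ≡⟨ split x as y bs ⟨
  pathArcs x ((as ++ y ∷ bs) ∷ʳ x)              ∎
  where
  open PermutationReasoning
  split : ∀ (x : _) as y bs → pathArcs x ((as ++ y ∷ bs) ∷ʳ x) ≡
    pathArcs x (as ∷ʳ y) ++ pathArcs y (bs ∷ʳ x)
  split x as y bs = trans (cong (pathArcs x) (++-assoc as (y ∷ bs) (x ∷ [])))
    (pathArcs-++ x as y (bs ∷ʳ x))

mutual
  -- The loop local to cycLen has no name outside Defs; the equation below makes
  -- the unifier produce it, once every argument of the loop is a distinct variable.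
  search : ∀ {n} → (Fin n → Fin n) → Fin n → ℕ → ℕ → ℕ
  search = _

  cycLen-search : ∀ {n} (σ : Fin (suc n) → Fin (suc n)) i →
    cycLen σ i ≡ (if iter σ 1 i ≡ᶠ i then 1 else search σ i 2 n)
  cycLen-search {n} σ i with suc n | σ | i | 2
  ... | _ | _ | _ | _ = refl

-- `k` is the candidate under test, `d` its distance from the first return and `f` the number of
-- tests left. Running out of tests yields `k` itself, so `d = f` is allowed.
search-finds : ∀ {n} (σ : Fin n → Fin n) i d k f → d ℕ.≤ f → iter σ (d ℕ.+ k) i ≡ i →
  (∀ {j} → j ℕ.< d → iter σ (j ℕ.+ k) i ≢ i) → search σ i k f ≡ d ℕ.+ k
search-finds σ i zero    k zero    _ e ne = refl
search-finds σ i zero    k (suc f) _ e ne rewrite ≡⇒≡ᶠ (iter σ k i) i e = refl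
search-finds σ i (suc d) k (suc f) (ℕ.s≤s d≤f) e ne with iter σ k i ≡ᶠ i in q
... | true  = ⊥-elim (ne ℕ.z<s (≡ᶠ⇒≡ (iter σ k i) i q))
... | false = trans
      (search-finds σ i d (suc k) f d≤f (trans (cong (λ m → iter σ m i) (ℕ.+-suc d k)) e)
        (λ {j} j<d → ne (ℕ.s<s j<d) ∘ trans (cong (λ m → iter σ m i) (sym (ℕ.+-suc j k)))))
      (ℕ.+-suc d k)

applyUpTo-cong : {f g : ℕ → A} → (∀ j → f j ≡ g j) → ∀ m → applyUpTo f m ≡ applyUpTo g m
applyUpTo-cong e zero    = refl
applyUpTo-cong e (suc m) = cong₂ _∷_ (e 0) (applyUpTo-cong (e ∘ suc) m)

iter-suc : ∀ {n} (σ : Fin n → Fin n) j i → iter σ (suc j) i ≡ iter σ j (σ i)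
iter-suc σ zero    i = refl
iter-suc σ (suc j) i = cong σ (iter-suc σ j i)

iterArc : ∀ {n} → (Fin n → Fin n) → Fin n → ℕ → Arc n
iterArc σ x j = iter σ j x , iter σ (suc j) x

iterArcs : ∀ {n} (σ : Fin n → Fin n) x ys z → All (Follows σ) (pathArcs x (ys ∷ʳ z)) →
  applyUpTo (iterArc σ x) (suc (length ys)) ≡ pathArcs x (ys ∷ʳ z)
iterArcs σ x []       z (e ∷ []) = cong (λ w → (x , w) ∷ []) e
iterArcs σ x (y ∷ ys) z (e ∷ p)  = cong₂ _∷_ (cong (x ,_) e) (trans
  (applyUpTo-cong (λ j → cong₂ _,_ (shift j) (cong σ (shift j))) (suc (length ys)))
  (iterArcs σ y ys z p))
  where
  shift : ∀ j → iter σ (suc j) x ≡ iter σ j y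
  shift j = trans (iter-suc σ j x) (cong (iter σ j) e)

iterates : ∀ {n} (σ : Fin n → Fin n) x ys → All (Follows σ) (pathArcs x ys) →
  applyUpTo (λ j → iter σ (suc j) x) (length ys) ≡ ys
iterates σ x []       []      = refl
iterates σ x (y ∷ ys) (e ∷ p) = cong₂ _∷_ e (trans
  (applyUpTo-cong (λ j → trans (iter-suc σ (suc j) x) (cong (iter σ (suc j)) e)) (length ys))
  (iterates σ y ys p))

iter-length : ∀ {n} (σ : Fin n → Fin n) x ys z → All (Follows σ) (pathArcs x (ys ∷ʳ z)) →
  iter σ (suc (length ys)) x ≡ z
iter-length σ x []       z (e ∷ []) = e
iter-length σ x (y ∷ ys) z (e ∷ p)  = trans (iter-suc σ (suc (length ys)) x)
  (trans (cong (iter σ (suc (length ys))) e) (iter-length σ y ys z p))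

record IsCycle {n} (σ : Fin n → Fin n) (x : Fin n) (ys : List (Fin n)) : Set where
  field
    arcs   : All (Follows σ) (cycleArcs (x , ys))
    unique : Unique (x ∷ ys)
    -- Gives the search in `cycLen` enough tests.
    short  : length ys ℕ.≤ n

module CycleProperties {n} {σ : Fin n → Fin n} {x ys} (C : IsCycle σ x ys) where
  open IsCycle C

  -- The iterates of `x` pass through `ys`, where uniqueness excludes `x`, and then return.
  cycLen≡ : cycLen σ x ≡ suc (length ys)
  cycLen≡ = trans
    (search-finds σ x (length ys) 1 n short
      (trans (cong (λ m → iter σ m x) (ℕ.+-comm (length ys) 1)) (iter-length σ x ys x arcs))
      (λ {j} j<l e → All.applyUpTo⁻ (λ j → iter σ (suc j) x) (length ys)
        (subst (All (x ≢_)) (sym (iterates σ x ys pre)) (AllPairs.head unique)) j<l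
        (sym (trans (cong (λ m → iter σ m x) (ℕ.+-comm 1 j)) e))))
    (ℕ.+-comm (length ys) 1)
    where
    pre : All (Follows σ) (pathArcs x ys)
    pre = All.tail (Perm.All-resp-↭ (↭-sym (pathArcs-∷ʳ x ys x)) arcs)

  -- `isCycleOf` and `isCycleRep` are both tests of this shape, so both become tests on the list of
  -- arcs.
  ∀Below-cycle : (p : Arc n → Bool) →
    ∀Below (cycLen σ x) (p ∘ iterArc σ x) ≡ and (map p (cycleArcs (x , ys)))
  ∀Below-cycle p = trans (cong (λ ℓ → ∀Below ℓ (p ∘ iterArc σ x)) cycLen≡) (cong and (trans
    (map-upTo (p ∘ iterArc σ x) (suc (length ys)))
    (trans (sym (map-applyUpTo (iterArc σ x) p (suc (length ys))))
      (cong (map p) (iterArcs σ x ys x arcs)))))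

  -- Tests on arcs give the same result from any starting vertex, since the arcs agree up to order;
  -- `x ∈ zs` serves to show that `y` is not the least vertex.
  rotate : ∀ {y} → y ∈ ys → ∃ λ zs → IsCycle σ y zs ×
    cycleArcs (y , zs) ↭ cycleArcs (x , ys) × x ∈ zs
  rotate {y} y∈ with as , bs , refl ← ∈-∃++ y∈ = zs , record
    { arcs   = Perm.All-resp-↭ (↭-sym p) arcs
    ; unique = Unique-resp-↭ (↭-sym q) unique
    ; short  = subst (ℕ._≤ n) (sym len) short
    } , p , ∈-++⁺ʳ bs (here refl)
    where
    zs = bs ++ x ∷ as
    p : cycleArcs (y , zs) ↭ cycleArcs (x , as ++ y ∷ bs)
    p = cycleArcs-rotate x as y bs
    q : y ∷ zs ↭ x ∷ as ++ y ∷ bs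
    -- The vertices are the sources of the arcs, so the permutation `p` of arcs induces one of
    -- vertices.
    q = ↭-trans (↭-reflexive (sym (sources-∷ʳ y zs y)))
      (↭-trans (Perm.map⁺ proj₁ p) (↭-reflexive (sources-∷ʳ x (as ++ y ∷ bs) x)))
    len : length zs ≡ length (as ++ y ∷ bs)
    len = ℕ.suc-injective (Perm.↭-length q)

and-↭ : (p : A → Bool) {xs ys : List A} → xs ↭ ys → and (map p xs) ≡ and (map p ys)
and-↭ p {xs} {ys} q with and (map p ys) in e
... | true  = and-map⁺ p xs (and-map⁻ p ys e ∘ Perm.∈-resp-↭ q)
... | false with and (map p xs) in e′
... | false = refl
... | true  = trans (sym (and-map⁺ p ys (and-map⁻ p xs e′ ∘ Perm.∈-resp-↭ (↭-sym q)))) e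

-- Weights of cycles and of vertices

module CycleWeights {n : ℕ} (D : Digraph n) where

  b : Fin n → Fin n → ℤ
  b = arcWeight D

  ∏[1+b] ∏[b] : List (Arc n) → ℤ
  ∏[1+b] L = ∏ L (λ (u , v) → 1ℤ + b u v)
  ∏[b]   L = ∏ L (λ (u , v) → b u v)

  cycleWeight : Fin n × List (Fin n) → ℤ
  cycleWeight C = ∏[1+b] (cycleArcs C) - ∏[b] (cycleArcs C)

  within : Digraph n → List (Arc n) → Bool
  within E L = and (map (uncurry E) L)

  ∏[1+b]-within : ∀ L → ∏[1+b] L ≡ (if within (complement D) L then 1ℤ else 0ℤ)
  ∏[1+b]-within []            = refl
  ∏[1+b]-within ((u , v) ∷ L) with D u v
  ... | true  = refl
  ... | false = trans (*-identityˡ _) (∏[1+b]-within L)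

  ∏[b]-within : ∀ L → ∏[b] L ≡ (if within D L then -1ℤ ^ length L else 0ℤ)
  ∏[b]-within []            = refl
  ∏[b]-within ((u , v) ∷ L) with D u v
  ... | false = refl
  ... | true  with within D L | ∏[b]-within L
  ... | true  | e = cong (-1ℤ *_) e
  ... | false | e = cong (-1ℤ *_) e

  -- The list of arcs is nonempty, and its first arc belongs to only one of the two digraphs.
  within-exclusive : ∀ x ys z → within D (pathArcs x (ys ∷ʳ z)) ≡ true →
    within (complement D) (pathArcs x (ys ∷ʳ z)) ≡ false
  within-exclusive x []      z _ with true ← D x z = refl
  within-exclusive x (y ∷ _) z _ with true ← D x y = refl

  vertexExp : (Fin n → Fin n) → Fin n → ℕ
  vertexExp σ i = if isCycleRep σ i ∧ isCycleOf D σ i then cycLen σ i ℕ.∸ 1 else 0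

  vertexOK : (Fin n → Fin n) → Fin n → Bool
  vertexOK σ i = isCycleOf D σ i ∨ isCycleOf (complement D) σ i

  -- The test on `σ` and its sign, spread over the vertices so that they can be regrouped by cycles.
  vertexWeight : (Fin n → Fin n) → Fin n → ℤ
  vertexWeight σ i = (if vertexOK σ i then 1ℤ else 0ℤ) * -1ℤ ^ vertexExp σ i

  isDD̄-∏ : ∀ σ is → (if and (map (vertexOK σ) is) then -1ℤ ^ sum (map (vertexExp σ) is) else 0ℤ)
    ≡ ∏ is (vertexWeight σ)
  isDD̄-∏ σ []       = refl
  isDD̄-∏ σ (i ∷ is) with vertexOK σ i
  ... | false = sym (trans (cong (_* ∏ is (vertexWeight σ)) (*-zeroˡ (-1ℤ ^ vertexExp σ i)))
        (*-zeroˡ (∏ is (vertexWeight σ))))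
  ... | true  with and (map (vertexOK σ) is) | isDD̄-∏ σ is
  ... | true  | e = trans (^-distribˡ-+-* -1ℤ (vertexExp σ i) _)
        (cong₂ _*_ (sym (*-identityˡ (-1ℤ ^ vertexExp σ i))) e)
  ... | false | e = trans (sym (*-zeroʳ (1ℤ * -1ℤ ^ vertexExp σ i)))
        (cong (1ℤ * -1ℤ ^ vertexExp σ i *_) e)

  -- The start is then the vertex that `isCycleRep` selects.
  Least : Fin n × List (Fin n) → Set
  Least (x , ys) = All (x Fin.<_) ys

  -- All vertices of a cycle carry the same factor `ok`, which is 0 or 1, and only the least one
  -- carries the sign. A D-cycle of length ℓ gets (-1)^(ℓ-1) = 0 - (-1)^ℓ, a cycle of the complement
  -- gets 1 - 0, and any other gets 0.
  ∏-cycle : ∀ {σ x ys} → IsCycle σ x ys → Least (x , ys) →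
    ∏ (x ∷ ys) (vertexWeight σ) ≡ cycleWeight (x , ys)
  ∏-cycle {σ} {x} {ys} C least = begin
    vertexWeight σ x * ∏ ys (vertexWeight σ)
      ≡⟨ cong (_* ∏ ys (vertexWeight σ)) headW ⟩
    (ok * sgn) * ∏ ys (vertexWeight σ)
      ≡⟨ absorb ⟩
    ok * sgn
      ≡⟨ combine (within D L) (within (complement D) L) (within-exclusive x ys x)
           (length L) (length ys) lenL ⟩
    (if within (complement D) L then 1ℤ else 0ℤ) - (if within D L then -1ℤ ^ length L else 0ℤ)
      ≡⟨ cong₂ _-_ (∏[1+b]-within L) (∏[b]-within L) ⟨
    cycleWeight (x , ys) ∎
    where
    open ≡-Reasoning
    open CycleProperties
    L = cycleArcs (x , ys)
    ok sgn : ℤ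
    ok  = if within D L ∨ within (complement D) L then 1ℤ else 0ℤ
    sgn = -1ℤ ^ (if within D L then length ys else 0)

    lenL : length L ≡ suc (length ys)
    lenL = trans (sym (length-map proj₁ L)) (cong length (sources-∷ʳ x ys x))

    isCycleOf≡ : ∀ E → isCycleOf E σ x ≡ within E L
    isCycleOf≡ E = ∀Below-cycle C (uncurry E)

    isCycleOf≡′ : ∀ {y zs} (C′ : IsCycle σ y zs) → cycleArcs (y , zs) ↭ L →
      ∀ E → isCycleOf E σ y ≡ within E L
    isCycleOf≡′ C′ p E = trans (∀Below-cycle C′ (uncurry E)) (and-↭ (uncurry E) p)

    isRep-head : isCycleRep σ x ≡ true
    isRep-head = trans (∀Below-cycle C (λ a → toℕ x ℕ.≤ᵇ toℕ (proj₁ a)))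
      (and-map⁺ _ L (λ {a} m → ≤⇒true (leq
        (subst (proj₁ a ∈_) (sources-∷ʳ x ys x) (∈-map⁺ proj₁ m)))))
      where
      leq : ∀ {y} → y ∈ x ∷ ys → toℕ x ℕ.≤ toℕ y
      leq (here refl) = ℕ.≤-refl
      leq (there m)   = ℕ.<⇒≤ (All.lookup least m)
      ≤⇒true : ∀ {i j} → i ℕ.≤ j → (i ℕ.≤ᵇ j) ≡ true
      ≤⇒true {i} {j} i≤j with i ℕ.≤ᵇ j | ℕ.≤⇒≤ᵇ i≤j
      ... | true | _ = refl

    isRep-tail : ∀ {y zs} → y ∈ ys → IsCycle σ y zs → x ∈ zs → isCycleRep σ y ≡ false
    isRep-tail {y} {zs} y∈ C′ x∈
      with (.x , t) , m , refl ← ∈-map⁻ proj₁ (subst (x ∈_) (sym (sources-∷ʳ y zs y)) (there x∈)) =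
      trans (∀Below-cycle C′ (λ a → toℕ y ℕ.≤ᵇ toℕ (proj₁ a)))
        (and-map-false⁺ _ (cycleArcs (y , zs)) m (≰⇒false (ℕ.<⇒≱ (All.lookup least y∈))))
      where
      ≰⇒false : ∀ {i j} → i ℕ.≰ j → (i ℕ.≤ᵇ j) ≡ false
      ≰⇒false {i} {j} i≰j with i ℕ.≤ᵇ j in e
      ... | false = refl
      ... | true  = ⊥-elim (i≰j (ℕ.≤ᵇ⇒≤ i j (subst T (sym e) _)))

    headW : vertexWeight σ x ≡ ok * sgn
    headW rewrite isCycleOf≡ D | isCycleOf≡ (complement D) | isRep-head | cycLen≡ C = refl

    tailW : ∀ {y} → y ∈ ys → vertexWeight σ y ≡ ok
    tailW {y} y∈ with zs , C′ , p , x∈ ← rotate C y∈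
      rewrite isCycleOf≡′ C′ p D | isCycleOf≡′ C′ p (complement D) | isRep-tail y∈ C′ x∈
      = *-identityʳ ok

    absorb : (ok * sgn) * ∏ ys (vertexWeight σ) ≡ ok * sgn
    absorb with within D L ∨ within (complement D) L | tailW
    ... | true  | tw = trans (cong (1ℤ * sgn *_) (∏-one ys tw)) (*-identityʳ (1ℤ * sgn))
    ... | false | _  = trans (cong (_* ∏ ys (vertexWeight σ)) (*-zeroˡ sgn))
          (trans (*-zeroˡ (∏ ys (vertexWeight σ))) (sym (*-zeroˡ sgn)))

    combine : ∀ d d̄ → (d ≡ true → d̄ ≡ false) → ∀ ℓ m → ℓ ≡ suc m →
      (if d ∨ d̄ then 1ℤ else 0ℤ) * -1ℤ ^ (if d then m else 0) ≡
      (if d̄ then 1ℤ else 0ℤ) - (if d then -1ℤ ^ ℓ else 0ℤ)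
    combine false false ex ℓ m e = refl
    combine false true  ex ℓ m e = refl
    combine true  d̄     ex ℓ m refl with refl ← ex refl = ring (-1ℤ ^ m)
      where
      ring : ∀ z → 1ℤ * z ≡ 0ℤ - (- 1ℤ) * z
      ring = solve-∀

Pick-All : {P : V → Set} {S : Vec V (suc k)} {t : V} {S′ : Vec V k} → Pick S t S′ →
  All P (toList S) → All P (toList S′)
Pick-All here      (_ ∷ ps) = ps
Pick-All (there p) (q ∷ ps) = q ∷ Pick-All p ps

Pick-AllPairs : {R : V → V → Set} {S : Vec V (suc k)} {t : V} {S′ : Vec V k} → Pick S t S′ →
  AllPairs R (toList S) → AllPairs R (toList S′)
Pick-AllPairs here      (_ ∷ rs) = rs
Pick-AllPairs (there p) (r ∷ rs) = Pick-All p r ∷ Pick-AllPairs p rs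

-- The signed sum, built up cycle by cycle

module SignedSum {n : ℕ} (D : Digraph n) where
  open CycleWeights D
  open WeightedSums b

  -- The two filters become zero weights, so that the sum runs over all functions.
  W : (Fin n → Fin n) → ℤ
  W σ = if isInjective σ then (if isDD̄ D σ then -1ℤ ^ φ D σ else 0ℤ) else 0ℤ

  W-injective : ∀ σ → isInjective σ ≡ false → W σ ≡ 0ℤ
  W-injective σ e rewrite e = refl

  open ArcSums W W-injective

  signedSum≡arcSum : signedSum D ≡ arcSum []
  signedSum≡arcSum = begin
    ∑ (SDD̄ D) (λ σ → -1ℤ ^ φ D σ)
      ≡⟨ ∑-filterᵇ (isDD̄ D) (Perms n) _ ⟩
    ∑ (Perms n) (λ σ → if isDD̄ D σ then -1ℤ ^ φ D σ else 0ℤ)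
      ≡⟨ ∑-filterᵇ isInjective (allFuns n n) _ ⟩
    ∑ (allFuns n n) W
      ≡⟨ ∑-cong (allFuns n n) (λ σ → *-identityˡ (W σ)) ⟨
    arcSum [] ∎
    where open ≡-Reasoning

  Cycle : Set
  Cycle = Fin n × List (Fin n)

  vertices : List Cycle → List (Fin n)
  vertices = concatMap (λ (x , ys) → x ∷ ys)

  allArcs : List Cycle → List (Arc n)
  allArcs = concatMap cycleArcs

  sources-allArcs : ∀ Cs → map proj₁ (allArcs Cs) ≡ vertices Cs
  sources-allArcs []              = refl
  sources-allArcs ((x , ys) ∷ Cs) = trans (map-++ proj₁ (cycleArcs (x , ys)) (allArcs Cs))
    (cong₂ _++_ (sources-∷ʳ x ys x) (sources-allArcs Cs))

  -- Along each cycle the targets are the vertices shifted by one place.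
  targets-allArcs : ∀ Cs → map proj₂ (allArcs Cs) ↭ vertices Cs
  targets-allArcs []              = ↭-refl
  targets-allArcs ((x , ys) ∷ Cs) = ↭-trans
    (↭-reflexive (map-++ proj₂ (cycleArcs (x , ys)) (allArcs Cs)))
    (Perm.++⁺ (↭-trans (↭-reflexive (targets x (ys ∷ʳ x))) (↭-sym (Perm.∷↭∷ʳ x ys)))
      (targets-allArcs Cs))

  ∏-vertices : ∀ σ Cs → All (Follows σ) (allArcs Cs) → Unique (vertices Cs) →
    length (vertices Cs) ℕ.≤ n → All Least Cs →
    ∏ (vertices Cs) (vertexWeight σ) ≡ ∏ Cs cycleWeight
  ∏-vertices σ []              _ _ _ _ = refl
  ∏-vertices σ ((x , ys) ∷ Cs) f u l (m ∷ ms) = trans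
    (∏-++ (x ∷ ys) (vertices Cs) (vertexWeight σ))
    (cong₂ _*_ (∏-cycle record
        { arcs   = All.++⁻ˡ (cycleArcs (x , ys)) f
        ; unique = Unique-++⁻ˡ (x ∷ ys) u
        ; short  = ℕ.≤-trans (ℕ.m≤m+n (length ys) _) (ℕ.≤-trans (ℕ.n≤1+n _) len)
        } m)
      (∏-vertices σ Cs (All.++⁻ʳ (cycleArcs (x , ys)) f) (Unique-++⁻ʳ (x ∷ ys) u)
        (ℕ.≤-trans (ℕ.m≤n+m _ (suc (length ys))) len) ms))
    where
    len : suc (length ys) ℕ.+ length (vertices Cs) ℕ.≤ n
    len = subst (ℕ._≤ n) (length-++ (x ∷ ys)) l

  -- Following all arcs of disjoint cycles that cover the vertices makes `σ` a permutation with
  -- exactly these cycles, and its weight regroups over them.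
  W-total : ∀ Cs → allFin n ↭ vertices Cs → All Least Cs → ∀ σ → All (Follows σ) (allArcs Cs) →
    W σ ≡ ∏ Cs cycleWeight
  W-total Cs cover least σ f = begin
    W σ
      ≡⟨ cong (λ i → if i then (if isDD̄ D σ then -1ℤ ^ φ D σ else 0ℤ) else 0ℤ) injective ⟩
    (if isDD̄ D σ then -1ℤ ^ φ D σ else 0ℤ)
      ≡⟨ isDD̄-∏ σ (allFin n) ⟩
    ∏ (allFin n) (vertexWeight σ)
      ≡⟨ ∏-↭ (vertexWeight σ) cover ⟩
    ∏ (vertices Cs) (vertexWeight σ)
      ≡⟨ ∏-vertices σ Cs f uniq (ℕ.≤-reflexive
           (trans (sym (Perm.↭-length cover)) (length-tabulate (λ i → i)))) least ⟩
    ∏ Cs cycleWeight ∎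
    where
    open ≡-Reasoning
    uniq : Unique (vertices Cs)
    uniq = Unique-resp-↭ cover (allFin⁺ n)
    graph-∈ : ∀ i → (i , σ i) ∈ allArcs Cs
    graph-∈ i with (.i , t) , m , refl ← ∈-map⁻ proj₁
        (subst (i ∈_) (sym (sources-allArcs Cs)) (Perm.∈-resp-↭ cover (∈-allFin i)))
      = subst (λ t → (i , t) ∈ allArcs Cs) (sym (All.lookup f m)) m
    -- Each vertex is the target of only one arc, so equal values come from the same source.
    injective : isInjective σ ≡ true
    injective = isInjective⁺ σ λ i j e → cong proj₁
      (Unique-map-injective proj₂ (Unique-resp-↭ (↭-sym (targets-allArcs Cs)) uniq)
        (graph-∈ i) (graph-∈ j) e)

  arcSum-cycles : (Cs : List Cycle) (S : Vec (Fin n) k) →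
    allFin n ↭ vertices Cs ++ toList S → AllPairs Fin._<_ (toList S) → All Least Cs →
    arcSum (allArcs Cs) ≡ ∏ Cs cycleWeight * cycleSum S

  -- The value of `σ` at the end of the open path `x ∷ ys` closes the cycle, or extends it by a
  -- vertex of `S`, or hits a vertex that already has a preimage and contributes 0.
  arcSum-openCycle : (Cs : List Cycle) (x : Fin n) (ys : List (Fin n)) (S : Vec (Fin n) k) →
    allFin n ↭ (x ∷ ys) ++ vertices Cs ++ toList S →
    AllPairs Fin._<_ (toList S) → All (x Fin.<_) (toList S) → All Least ((x , ys) ∷ Cs) →
    arcSum (pathArcs x ys ++ allArcs Cs) ≡ ∏ Cs cycleWeight *
      openCycleSum (λ t → b t x) (b (end x ys) x) (b (end x ys))
        (∏[1+b] (pathArcs x ys)) (∏[b] (pathArcs x ys)) S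

  arcSum-cycles Cs [] cover sorted least = trans
    (arcSum-total (allArcs Cs) (∏ Cs cycleWeight)
      (subst Unique (sym (sources-allArcs Cs)) (Unique-resp-↭ cover′ (allFin⁺ n)))
      (λ i → subst (i ∈_) (sym (sources-allArcs Cs)) (Perm.∈-resp-↭ cover′ (∈-allFin i)))
      (W-total Cs cover′ least))
    (sym (*-identityʳ (∏ Cs cycleWeight)))
    where
    cover′ : allFin n ↭ vertices Cs
    cover′ = ↭-trans cover (Perm.++-identityʳ (vertices Cs))
  arcSum-cycles Cs (x ∷ S) cover (x< ∷ sorted) least =
    arcSum-openCycle Cs x [] S (↭-trans cover (Perm.shift x (vertices Cs) (toList S)))
      sorted x< ([] ∷ least)

  arcSum-openCycle {k} Cs x ys S cover sorted x< (x<ys ∷ least) = begin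
    arcSum L
      ≡⟨ arcSum-split u L ⟩
    ∑ (allFin n) next
      ≡⟨ ∑-↭ next cover ⟩
    next x + ∑ (ys ++ vertices Cs ++ toList S) next
      ≡⟨ cong (next x +_) (trans (∑-++ ys (vertices Cs ++ toList S) next)
           (cong₂ _+_ (∑-zero ys clash₁) (trans (∑-++ (vertices Cs) (toList S) next)
             (cong (_+ ∑ (toList S) next) (∑-zero (vertices Cs) clash₂))))) ⟩
    next x + (0ℤ + (0ℤ + ∑ (toList S) next))
      ≡⟨ cong (next x +_) (trans (+-identityˡ _) (+-identityˡ _)) ⟩
    next x + ∑ (toList S) next
      ≡⟨ cong (_+ ∑ (toList S) next) close ⟩
    ((α * (1ℤ + b u x) - β * b u x) * P) * cycleSum S + ∑ (toList S) next
      ≡⟨ finish S sorted x< cover ⟩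
    P * openCycleSum (λ t → b t x) (b u x) (b u) α β S ∎
    where
    open ≡-Reasoning
    u = end x ys
    L = pathArcs x ys ++ allArcs Cs
    α = ∏[1+b] (pathArcs x ys)
    β = ∏[b] (pathArcs x ys)
    P = ∏ Cs cycleWeight
    next : Fin n → ℤ
    next t = arcSum ((u , t) ∷ L)

    extend : ∀ t → (u , t) ∷ L ↭ pathArcs x (ys ∷ʳ t) ++ allArcs Cs
    extend t = Perm.++⁺ʳ (allArcs Cs) (pathArcs-∷ʳ x ys t)

    ∏[1+b]-∷ʳ : ∀ t → ∏[1+b] (pathArcs x (ys ∷ʳ t)) ≡ α * (1ℤ + b u t)
    ∏[1+b]-∷ʳ t = trans (sym (∏-↭ _ (pathArcs-∷ʳ x ys t))) (*-comm (1ℤ + b u t) α)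

    ∏[b]-∷ʳ : ∀ t → ∏[b] (pathArcs x (ys ∷ʳ t)) ≡ β * b u t
    ∏[b]-∷ʳ t = trans (sym (∏-↭ _ (pathArcs-∷ʳ x ys t))) (*-comm (b u t) β)

    -- Closing the cycle adds `u` to the sources of `L`, and all the sources are then distinct.
    u∉ : u ∉ map proj₁ L
    u∉ = Unique[x∷xs]⇒x∉xs (Unique-resp-↭ (↭-sym (Perm.map⁺ proj₁ (extend x)))
      (subst Unique (sym (sources-allArcs ((x , ys) ∷ Cs)))
        (Unique-++⁻ˡ (x ∷ ys ++ vertices Cs) (Unique-resp-↭
          (↭-trans cover (↭-reflexive (sym (++-assoc (x ∷ ys) (vertices Cs) (toList S)))))
          (allFin⁺ n)))))

    targets-L : map proj₂ L ≡ ys ++ map proj₂ (allArcs Cs)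
    targets-L = trans (map-++ proj₂ (pathArcs x ys) (allArcs Cs)) (cong (_++ _) (targets x ys))

    clash₁ : ∀ {t} → t ∈ ys → next t ≡ 0ℤ
    clash₁ {t} m = arcSum-clash u t L (subst (t ∈_) (sym targets-L) (∈-++⁺ˡ m)) u∉

    clash₂ : ∀ {t} → t ∈ vertices Cs → next t ≡ 0ℤ
    clash₂ {t} m = arcSum-clash u t L (subst (t ∈_) (sym targets-L)
      (∈-++⁺ʳ ys (Perm.∈-resp-↭ (↭-sym (targets-allArcs Cs)) m))) u∉

    close : next x ≡ ((α * (1ℤ + b u x) - β * b u x) * P) * cycleSum S
    close = begin
      next x
        ≡⟨ arcSum-↭ (extend x) ⟩
      arcSum (allArcs ((x , ys) ∷ Cs))
        ≡⟨ arcSum-cycles ((x , ys) ∷ Cs) S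
             (↭-trans cover (↭-reflexive (sym (++-assoc (x ∷ ys) (vertices Cs) (toList S)))))
             sorted (x<ys ∷ least) ⟩
      (cycleWeight (x , ys) * P) * cycleSum S
        ≡⟨ cong (λ w → w * P * cycleSum S) (cong₂ _-_ (∏[1+b]-∷ʳ x) (∏[b]-∷ʳ x)) ⟩
      ((α * (1ℤ + b u x) - β * b u x) * P) * cycleSum S ∎

    continue : ∀ {k} {S : Vec (Fin n) (suc k)} {t S′} → Pick S t S′ →
      AllPairs Fin._<_ (toList S) → All (x Fin.<_) (toList S) →
      allFin n ↭ (x ∷ ys) ++ vertices Cs ++ toList S →
      next t ≡ P * openCycleSum (λ t → b t x) (b t x) (b t) (α * (1ℤ + b u t)) (β * b u t) S′
    continue {S = S} {t} {S′} p sorted x< cover = begin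
      next t
        ≡⟨ arcSum-↭ (extend t) ⟩
      arcSum (pathArcs x (ys ∷ʳ t) ++ allArcs Cs)
        ≡⟨ arcSum-openCycle Cs x (ys ∷ʳ t) S′ (↭-trans cover (prep x moved))
             (Pick-AllPairs p sorted) (Pick-All p x<)
             (All.++⁺ x<ys (All.lookup x< (Pick-∈ p) ∷ []) ∷ least) ⟩
      P * openCycleSum (λ t → b t x) (b (end x (ys ∷ʳ t)) x) (b (end x (ys ∷ʳ t)))
        (∏[1+b] (pathArcs x (ys ∷ʳ t))) (∏[b] (pathArcs x (ys ∷ʳ t))) S′
        ≡⟨ cong (P *_) (cong₃ (λ e → openCycleSum (λ t → b t x) (b e x) (b e))
             (end-∷ʳ x ys t) (∏[1+b]-∷ʳ t) (∏[b]-∷ʳ t)) ⟩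
      P * openCycleSum (λ t → b t x) (b t x) (b t) (α * (1ℤ + b u t)) (β * b u t) S′ ∎
      where
      moved : ys ++ vertices Cs ++ toList S ↭ (ys ∷ʳ t) ++ vertices Cs ++ toList S′
      moved = ↭-trans
        (Perm.++⁺ˡ ys (↭-trans (Perm.++⁺ˡ (vertices Cs) (Pick-↭ p))
          (Perm.shift t (vertices Cs) (toList S′))))
        (↭-reflexive (sym (++-assoc ys (t ∷ []) (vertices Cs ++ toList S′))))
      cong₃ : ∀ {A B C : Set} (h : A → B → C → Vec (Fin n) _ → ℤ) {a a′ b b′ c c′} →
        a ≡ a′ → b ≡ b′ → c ≡ c′ → h a b c S′ ≡ h a′ b′ c′ S′
      cong₃ h refl refl refl = refl

    -- `S` is taken again with its hypotheses so that the empty and the nonempty case can be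
    -- separated.
    finish : ∀ {k} (S : Vec (Fin n) k) → AllPairs Fin._<_ (toList S) → All (x Fin.<_) (toList S) →
      allFin n ↭ (x ∷ ys) ++ vertices Cs ++ toList S →
      ((α * (1ℤ + b u x) - β * b u x) * P) * cycleSum S + ∑ (toList S) next ≡
      P * openCycleSum (λ t → b t x) (b u x) (b u) α β S
    finish [] _ _ _ = ring (α * (1ℤ + b u x) - β * b u x) P 1ℤ
      where
      ring : ∀ c p r → (c * p) * r + 0ℤ ≡ p * (c * r)
      ring = solve-∀
    finish S@(_ ∷ _) sorted x< cover = trans
      (cong (((α * (1ℤ + b u x) - β * b u x) * P) * cycleSum S +_)
        (trans (sym (Σpick-toList S next))
          (trans (Σpick-congᴾ S (λ p → continue p sorted x< cover)) (Σpick-* S P _))))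
      (ring (α * (1ℤ + b u x) - β * b u x) P (cycleSum S) _)
      where
      ring : ∀ c p r q → (c * p) * r + p * q ≡ p * (c * r + q)
      ring = solve-∀

-- Parity of a signed sum, and the theorem

∑-signs-parity : (f : A → ℕ) (xs : List A) →
  ∃ λ d → ∑ xs (λ x → -1ℤ ^ f x) + ℤ.+ (d ℕ.* 2) ≡ ℤ.+ length xs
∑-signs-parity f []       = 0 , refl
∑-signs-parity f (x ∷ xs) with ∑-signs-parity f xs | sign (f x)
  where
  sign : ∀ m → (-1ℤ ^ m ≡ 1ℤ) ⊎ (-1ℤ ^ m ≡ -1ℤ)
  sign zero = inj₁ refl
  sign (suc m) with sign m
  ... | inj₁ e = inj₂ (cong (-1ℤ *_) e)
  ... | inj₂ e = inj₁ (cong (-1ℤ *_) e)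
... | d , e | inj₁ s = d , trans (cong (λ z → z + S + ℤ.+ (d ℕ.* 2)) s)
      (trans (+-assoc 1ℤ S (ℤ.+ (d ℕ.* 2))) (cong (1ℤ +_) e))
  where S = ∑ xs (λ x → -1ℤ ^ f x)
-- A sign -1 is 2 less than 1, so `d` counts the negative signs.
... | d , e | inj₂ s = suc d , trans (cong (λ z → z + S + ℤ.+ (2 ℕ.+ d ℕ.* 2)) s)
      (trans (ring S (ℤ.+ (d ℕ.* 2))) (cong (1ℤ +_) e))
  where
  S = ∑ xs (λ x → -1ℤ ^ f x)
  ring : ∀ s d → - 1ℤ + s + (1ℤ + 1ℤ + d) ≡ 1ℤ + (s + d)
  ring = solve-∀

open import Data.Integer using (+_)

theorem6p6 : (n : ℕ) (D : Digraph n) →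
    (+ length (hamps (complement D)) ≡ signedSum D)
    × (length (hamps (complement D)) % 2 ≡ length (SDD̄ D) % 2)
theorem6p6 n D = hamps≡signedSum , parity
  where
  open WeightedSums (arcWeight D)
  open SignedSum D
  open ArcSums W W-injective

  m = length (hamps (complement D))

  hamps≡signedSum : + m ≡ signedSum D
  hamps≡signedSum = begin
    + m                      ≡⟨ HampCount.length-hamps D ⟩
    pathSum 𝟎 (Vec.allFin n) ≡⟨ cycleSum≡pathSum (Vec.allFin n) ⟨
    -- The factor 1 is the empty product over cycles already fixed.
    cycleSum (Vec.allFin n)  ≡⟨ *-identityˡ _ ⟨
    1ℤ * cycleSum (Vec.allFin n)
      ≡⟨ arcSum-cycles [] (Vec.allFin n) (↭-reflexive (sym (toList-allFin n)))
           (subst (AllPairs Fin._<_) (sym (toList-allFin n)) (AllPairs.tabulate⁺-< (λ i<j → i<j)))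
           [] ⟨
    arcSum []                ≡⟨ signedSum≡arcSum ⟨
    signedSum D              ∎
    where open ≡-Reasoning

  parity : m % 2 ≡ length (SDD̄ D) % 2
  -- Adding 2d to the signed sum gives the number of permutations; with `m` for the signed sum both
  -- sides are natural numbers, so the equation passes from ℤ to ℕ.
  parity with d , e ← ∑-signs-parity (φ D) (SDD̄ D) = trans (sym ([m+kn]%n≡m%n m d 2))
    (cong (_% 2) (+-injective (trans (cong (_+ (+ (d ℕ.* 2))) hamps≡signedSum) e)))
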